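{- The set $\mathbb Q^+$ of positive rational numbers, canonically arranged as below, has size sequence $$\sigma(\mathbb Q^+)=(\alpha+1)\cdot\sigma(\mathbb I),\quad\text{i.e. } \sigma_n(\mathbb Q^+)=(n+1)\Phi(n),$$ where $\Phi(n)=\sum_{i=1}^n\varphi(i)$ with $\varphi$ Euler's totient function; moreover $\sigma(\mathbb Q^+)\approx_\mathcal F\alpha^3$, and more precisely $$\tfrac{3}{10}(\alpha^3+\alpha^2)<_\mathcal F\sigma(\mathbb Q^+)<_\mathcal F\frac{\alpha^3-\alpha}{2}.$$
   Context: $\mathbb N=\{1,2,\dots\}$. Every positive rational is uniquely written as a mixed fraction $p+k/m$ with $p\in\mathbb N_0$, $k,m\in\mathbb N$, $\gcd(k,m)=1$, $k\le m$, and is represented by the triple $(p,k,m)$; thus $\mathbb Q^+=\mathbb N_0\times\mathbb I$ where $\mathbb I=(0,1]\cap\mathbb Q$ is represented by the pairs $(k,m)$. Arrangements: $\mathbb N_0$ has first component $\{0,1\}$ and $n$-th component $\{n\}$ for $n\ge2$; $\mathbb I$ has $n$-th component $\{(k,n):\gcd(k,n)=1,k\le n\}$; a product $A\times B$ has $n$-th component $\bigcup\{A_i\times B_j:\max\{i,j\}=n\}$. Hence the triple $(p,k,m)$ lies in component $\max\{\ell(p),m\}$ where $\ell(0)=1$ and $\ell(p)=p$ for $p\ge1$. The size sequence is $\sigma(A)=(\sigma_n(A))_n$, $\sigma_n(A)=|A_1|+\dots+|A_n|$. $\alpha=(n)_n$; operations on sequences are componentwise; constants are identified with constant sequences. $(a_n)<_\mathcal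 F(b_n)$ iff $a_n<b_n$ for all sufficiently large $n$; $(a_n)\approx_\mathcal F(b_n)$ iff some $k\in\mathbb N$ has $ka_n\ge b_n$ for all large $n$ and some $k$ has $kb_n\ge a_n$ for all large $n$. -}

module Defs where

open import Algebra.Definitions.RawSemiring using () renaming (_^_ to pow)
open import Data.Integer.Base using (+_)
import Data.Integer.Base as ℤ
import Data.Integer.Properties as ℤ
open import Data.List.Base
  using (List; []; _∷_; map; filter; concat; length; upTo; applyUpTo; cartesianProduct)
open import Data.List.Membership.Propositional using (_∈_)
open import Data.List.Membership.Propositional.Properties
  using ( ∈-map⁺; ∈-map⁻; ∈-filter⁺; ∈-filter⁻; ∈-applyUpTo⁺; ∈-applyUpTo⁻; ∈-upTo⁺
        ; ∈-concat⁺′; ∈-concat⁻′; ∈-cartesianProduct⁺; ∈-cartesianProduct⁻)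
open import Data.List.Relation.Unary.All as All using (All; []; _∷_)
import Data.List.Relation.Unary.All.Properties as All
open import Data.List.Relation.Unary.AllPairs as AllPairs using ([]; _∷_)
import Data.List.Relation.Unary.AllPairs.Properties as AllPairs
open import Data.List.Relation.Unary.Any using (here; there)
open import Data.List.Relation.Unary.Unique.Propositional using (Unique)
import Data.List.Relation.Unary.Unique.Propositional.Properties as Unique
open import Data.Nat.Base as ℕ using (ℕ; zero; suc; z≤n; s≤s; _⊔_)
import Data.Nat.Properties as ℕ
open import Data.Nat.Coprimality using (Coprime; coprime?; 1-coprimeTo) renaming (sym to coprime-sym)
open import Data.Product.Base using (∃; ∃₂; Σ; _×_; _,_; proj₁; proj₂)
open import Data.Rational.Base as ℚ using (ℚ; mkℚ; 0ℚ; 1ℚ; _/_; *<*; *≤*)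
import Data.Rational.Properties as ℚ
open import Data.Rational.Unnormalised.Base using (mkℚᵘ)
open import Data.Sum.Base using (_⊎_; inj₁; inj₂)
open import Function.Base using (_∘_)
open import Level using (0ℓ)
open import Relation.Binary.Definitions using (tri<; tri≈; tri>)
open import Relation.Binary.PropositionalEquality
  using (_≡_; _≢_; refl; sym; trans; cong; cong₂; subst; subst₂; module ≡-Reasoning)
open import Relation.Nullary using (¬_; Dec; yes; no; contradiction)
open import Relation.Nullary.Decidable using (recompute)
open import Relation.Unary using (Pred; ∅; U; Empty; _≐_; ⋃; _⟨×⟩_)

private
  variable
    A B : Set

record Enumeration (P : Pred A 0ℓ) : Set where
  field
    elements : List A
    unique   : Unique elements
    sound    : ∀ {x} → x ∈ elements → P x
    complete : ∀ {x} → P x → x ∈ elements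

  cardinality : ℕ
  cardinality = length elements

-- Components are numbered from 1; index 0 is a dummy, forced to be empty.
record Arrangement (S : Pred A 0ℓ) : Set₁ where
  field
    component : ℕ → Pred A 0ℓ
    finite    : ∀ n → Enumeration (component n)
    empty₀    : Empty (component 0)
    disjoint  : ∀ {m n x} → component m x → component n x → m ≡ n
    union     : S ≐ ⋃ ℕ component

-- ∑₁ n f = f 1 + … + f n
∑₁ : ℕ → (ℕ → ℕ) → ℕ
∑₁ zero    f = 0
∑₁ (suc n) f = ∑₁ n f ℕ.+ f (suc n)

size : {S : Pred A 0ℓ} → Arrangement S → ℕ → ℕ
size 𝒜 n = ∑₁ n λ i → Enumeration.cardinality (Arrangement.finite 𝒜 i)

-- Sequences are indexed by {1,2,…}: the relations below ignore the value at 0.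

Seq : Set
Seq = ℕ → ℚ

fromℕ : ℕ → ℚ
fromℕ n = + n / 1

const : ℚ → Seq
const c _ = c

α : Seq
α = fromℕ

σ : {S : Pred A 0ℓ} → Arrangement S → Seq
σ 𝒜 n = fromℕ (size 𝒜 n)

infixl 6 _+_ _-_
infixl 7 _*_
infixr 8 _^_

_+_ _-_ _*_ : Seq → Seq → Seq
(a + b) n = a n ℚ.+ b n
(a - b) n = a n ℚ.- b n
(a * b) n = a n ℚ.* b n

_^_ : Seq → ℕ → Seq
(a ^ k) n = pow ℚ.+-*-rawSemiring (a n) k

Eventually : Pred ℕ 0ℓ → Set
Eventually P = ∃ λ N → ∀ n → n ℕ.≥ N → P n

infix 4 _≋_ _<ℱ_ _≈ℱ_

_≋_ _<ℱ_ _≈ℱ_ : Seq → Seq → Set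
a ≋ b  = ∀ n → n ℕ.≥ 1 → a n ≡ b n
a <ℱ b = Eventually λ n → a n ℚ.< b n
a ≈ℱ b = (∃ λ k → k ℕ.≥ 1 × Eventually λ n → fromℕ k ℚ.* a n ℚ.≥ b n)
       × (∃ λ k → k ℕ.≥ 1 × Eventually λ n → fromℕ k ℚ.* b n ℚ.≥ a n)

totatives : ℕ → List ℕ
totatives n = filter (λ k → coprime? k n) (applyUpTo suc n)

φ : ℕ → ℕ
φ n = length (totatives n)

Φ : ℕ → ℕ
Φ n = ∑₁ n φ

totatives-sound : ∀ n {k} → k ∈ totatives n → 1 ℕ.≤ k × k ℕ.≤ n × Coprime k n
totatives-sound n k∈ with ∈-filter⁻ (λ k → coprime? k n) {xs = applyUpTo suc n} k∈
... | k∈′ , c with ∈-applyUpTo⁻ suc k∈′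
... | i , i<n , refl = s≤s z≤n , i<n , c

totatives-complete : ∀ n {k} → 1 ℕ.≤ k → k ℕ.≤ n → Coprime k n → k ∈ totatives n
totatives-complete n {suc k} _ k<n c =
  ∈-filter⁺ (λ k → coprime? k n) (∈-applyUpTo⁺ suc k<n) c

totatives-unique : ∀ n → Unique (totatives n)
totatives-unique n = Unique.filter⁺ (λ k → coprime? k n)
  (Unique.applyUpTo⁺₁ suc n λ i<j _ eq → ℕ.<⇒≢ i<j (ℕ.suc-injective eq))

ℕ₀-component : ℕ → Pred ℕ 0ℓ
ℕ₀-component 0             = ∅
ℕ₀-component 1             = λ p → p ≡ 0 ⊎ p ≡ 1
ℕ₀-component (suc (suc n)) = λ p → p ≡ suc (suc n)

ℕ₀-arrangement : Arrangement {ℕ} U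
ℕ₀-arrangement = record
  { component = ℕ₀-component
  ; finite    = finite
  ; empty₀    = λ _ ()
  ; disjoint  = λ {m} {n} → disjoint m n
  ; union     = (λ {p} _ → cover p) , λ _ → _
  }
  where
  finite : ∀ n → Enumeration (ℕ₀-component n)
  finite 0 = record
    { elements = [] ; unique = [] ; sound = λ () ; complete = λ () }
  finite 1 = record
    { elements = 0 ∷ 1 ∷ []
    ; unique   = ((λ ()) ∷ []) ∷ [] ∷ []
    ; sound    = λ { (here eq) → inj₁ eq ; (there (here eq)) → inj₂ eq }
    ; complete = λ { (inj₁ eq) → here eq ; (inj₂ eq) → there (here eq) }
    }
  finite (suc (suc n)) = record
    { elements = suc (suc n) ∷ []
    ; unique   = [] ∷ []
    ; sound    = λ { (here eq) → eq }
    ; complete = here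
    }

  disjoint : ∀ m n {p} → ℕ₀-component m p → ℕ₀-component n p → m ≡ n
  disjoint 1             1             _           _           = refl
  disjoint 1             (suc (suc _)) (inj₁ refl) ()
  disjoint 1             (suc (suc _)) (inj₂ refl) ()
  disjoint (suc (suc _)) 1             refl        (inj₁ ())
  disjoint (suc (suc _)) 1             refl        (inj₂ ())
  disjoint (suc (suc _)) (suc (suc _)) refl        eq          = eq

  cover : ∀ p → ∃ λ n → ℕ₀-component n p
  cover 0             = 1 , inj₁ refl
  cover 1             = 1 , inj₂ refl
  cover (suc (suc p)) = suc (suc p) , refl

𝕀 : Pred ℚ 0ℓ
𝕀 q = 0ℚ ℚ.< q × q ℚ.≤ 1ℚ

𝕀-component : ℕ → Pred ℚ 0ℓ
𝕀-component zero      = ∅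
𝕀-component n@(suc _) = λ q →
  ∃ λ k → 1 ℕ.≤ k × k ℕ.≤ n × Coprime k n × q ≡ + k / n

𝕀-arrangement : Arrangement 𝕀
𝕀-arrangement = record
  { component = 𝕀-component
  ; finite    = finite
  ; empty₀    = λ _ ()
  ; disjoint  = λ {m} {n} → disjoint m n
  ; union     = cover _ , λ { (n , c) → contained n c }
  }
  where
  denominator : ∀ n {q} → 𝕀-component n q → ℚ.↧ₙ q ≡ n
  denominator (suc n) (k , _ , _ , c , refl) = cong ℚ.↧ₙ_ (ℚ.normalize-coprime c)

  finite : ∀ n → Enumeration (𝕀-component n)
  finite zero = record
    { elements = [] ; unique = [] ; sound = λ () ; complete = λ () }
  finite n@(suc _) = record
    { elements = map (λ k → + k / n) (totatives n)
    ; unique   = Unique.map⁺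
        (λ {k} {l} eq → ℕ.*-cancelʳ-≡ k l n (ℚ.normalize-injective-≃ k l n n eq))
        (totatives-unique n)
    ; sound    = λ q∈ → let k , k∈ , eq = ∈-map⁻ _ q∈
                            1≤k , k≤n , c = totatives-sound n k∈
                        in k , 1≤k , k≤n , c , eq
    ; complete = λ { (k , 1≤k , k≤n , c , refl) →
                     ∈-map⁺ _ (totatives-complete n 1≤k k≤n c) }
    }

  disjoint : ∀ m n {q} → 𝕀-component m q → 𝕀-component n q → m ≡ n
  disjoint m n cm cn = trans (sym (denominator m cm)) (denominator n cn)

  cover : ∀ q → 𝕀 q → ∃ λ n → 𝕀-component n q
  cover q@(mkℚ (+ zero)    d-1 c) (*<* (ℤ.+<+ ()) , _)
  cover q@(mkℚ (ℤ.-[1+ _ ]) d-1 c) (*<* () , _)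
  cover q@(mkℚ (+ suc k)   d-1 c) (_ , *≤* q≤1) =
    suc d-1 , suc k , s≤s z≤n
    , ℤ.drop‿+≤+ (subst₂ ℤ._≤_ (ℤ.*-identityʳ _) (ℤ.*-identityˡ _) q≤1)
    , coprime , sym (ℚ.normalize-coprime c)
    where
    coprime : Coprime (suc k) (suc d-1)
    coprime = recompute (coprime? (suc k) (suc d-1)) c

  contained : ∀ n {q} → 𝕀-component n q → 𝕀 q
  contained (suc n) (suc k , _ , k≤n , c , refl)
    rewrite ℚ.normalize-coprime c
    = *<* (subst₂ ℤ._<_ (sym (ℤ.*-zeroˡ (+ suc n))) (sym (ℤ.*-identityʳ (+ suc k)))
            (ℤ.+<+ (s≤s z≤n)))
    , *≤* (subst₂ ℤ._≤_ (sym (ℤ.*-identityʳ _)) (sym (ℤ.*-identityˡ _)) (ℤ.+≤+ k≤n))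

infixr 2 _⊗_

_⊗_ : {S : Pred A 0ℓ} {T : Pred B 0ℓ} →
      Arrangement S → Arrangement T → Arrangement (S ⟨×⟩ T)
_⊗_ {A} {B} {S} {T} 𝒜 ℬ = record
  { component = comp
  ; finite    = λ n → record
    { elements = concat (map block (indices n))
    ; unique   = Unique.concat⁺
        (All.map⁺ (All.tabulate λ {ij} _ → block-unique ij))
        (AllPairs.map⁺ (AllPairs.map block-disjoint (indices-unique n)))
    ; sound    = sound n
    ; complete = complete n
    }
  ; empty₀    = λ { _ (zero  , _     , _  , a , _) → 𝒜.empty₀ _ a
                  ; _ (suc _ , zero  , () , _)
                  ; _ (suc _ , suc _ , () , _) }
  ; disjoint  = λ { (_ , _ , eq , a , b) (_ , _ , eq′ , a′ , b′) →
                    trans (sym eq)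
                      (trans (cong₂ _⊔_ (𝒜.disjoint a a′) (ℬ.disjoint b b′)) eq′) }
  ; union     = (λ { (s , t) → let i , a = proj₁ 𝒜.union s
                                   j , b = proj₁ ℬ.union t
                               in i ⊔ j , i , j , refl , a , b })
              , (λ { (_ , i , j , _ , a , b) →
                     proj₂ 𝒜.union (i , a) , proj₂ ℬ.union (j , b) })
  }
  where
  module 𝒜 = Arrangement 𝒜
  module ℬ = Arrangement ℬ
  module 𝒜ᶠ i = Enumeration (𝒜.finite i)
  module ℬᶠ j = Enumeration (ℬ.finite j)

  comp : ℕ → Pred (A × B) 0ℓ
  comp n (a , b) = ∃₂ λ i j → i ⊔ j ≡ n × 𝒜.component i a × ℬ.component j b

  block : ℕ × ℕ → List (A × B)
  block (i , j) = cartesianProduct (𝒜ᶠ.elements i) (ℬᶠ.elements j)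

  block-sound : ∀ ((i , j) : ℕ × ℕ) {a b} → (a , b) ∈ block (i , j) →
                𝒜.component i a × ℬ.component j b
  block-sound (i , j) x∈ =
    let a∈ , b∈ = ∈-cartesianProduct⁻ (𝒜ᶠ.elements i) (ℬᶠ.elements j) x∈
    in 𝒜ᶠ.sound i a∈ , ℬᶠ.sound j b∈

  block-unique : ∀ ij → Unique (block ij)
  block-unique (i , j) = Unique.cartesianProduct⁺ (𝒜ᶠ.unique i) (ℬᶠ.unique j)

  block-disjoint : ∀ {ij kl} → ij ≢ kl → ∀ {x} → ¬ (x ∈ block ij × x ∈ block kl)
  block-disjoint {ij} {kl} ij≢kl (x∈ , x∈′) =
    let a , b = block-sound ij x∈ ; a′ , b′ = block-sound kl x∈′
    in ij≢kl (cong₂ _,_ (𝒜.disjoint a a′) (ℬ.disjoint b b′))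

  max? : ∀ n ((i , j) : ℕ × ℕ) → Dec (i ⊔ j ≡ n)
  max? n (i , j) = i ⊔ j ℕ.≟ n

  square : ℕ → List (ℕ × ℕ)
  square n = cartesianProduct (upTo (suc n)) (upTo (suc n))

  indices : ℕ → List (ℕ × ℕ)
  indices n = filter (max? n) (square n)

  indices-unique : ∀ n → Unique (indices n)
  indices-unique n = Unique.filter⁺ (max? n)
    (Unique.cartesianProduct⁺ (Unique.upTo⁺ (suc n)) (Unique.upTo⁺ (suc n)))

  sound : ∀ n {x} → x ∈ concat (map block (indices n)) → comp n x
  sound n x∈ with ∈-concat⁻′ (map block (indices n)) x∈
  ... | _ , x∈b , b∈ with ∈-map⁻ block b∈
  ... | ij , ij∈ , refl =
    let a , b = block-sound ij x∈b
    in proj₁ ij , proj₂ ij , proj₂ (∈-filter⁻ (max? n) {xs = square n} ij∈) , a , b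

  complete : ∀ n {x} → comp n x → x ∈ concat (map block (indices n))
  complete n (i , j , refl , a , b) = ∈-concat⁺′
    (∈-cartesianProduct⁺ (𝒜ᶠ.complete i a) (ℬᶠ.complete j b))
    (∈-map⁺ block (∈-filter⁺ (max? n)
      (∈-cartesianProduct⁺ (∈-upTo⁺ (s≤s (ℕ.m≤m⊔n i j))) (∈-upTo⁺ (s≤s (ℕ.m≤n⊔m i j))))
      refl))

transport : {S : Pred A 0ℓ} {T : Pred B 0ℓ} (f : A → B) →
            (∀ {x} → S x → T (f x)) →
            (∀ {x y} → S x → S y → f x ≡ f y → x ≡ y) →
            (∀ {y} → T y → ∃ λ x → S x × f x ≡ y) →
            Arrangement S → Arrangement T
transport {A} {B} {S} {T} f into injective onto 𝒜 = record
  { component = λ n y → ∃ λ x → 𝒜.component n x × f x ≡ y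
  ; finite    = λ n → record
    { elements = map f (𝒜ᶠ.elements n)
    ; unique   = map-unique (All.tabulate λ x∈ → proj₂ 𝒜.union (n , 𝒜ᶠ.sound n x∈))
                            (𝒜ᶠ.unique n)
    ; sound    = λ y∈ → let x , x∈ , eq = ∈-map⁻ f y∈ in x , 𝒜ᶠ.sound n x∈ , sym eq
    ; complete = λ { (x , c , refl) → ∈-map⁺ f (𝒜ᶠ.complete n c) }
    }
  ; empty₀    = λ { _ (x , c , _) → 𝒜.empty₀ x c }
  ; disjoint  = λ { {m} {n} (x , c , eq) (x′ , c′ , eq′) →
                    𝒜.disjoint c (subst (𝒜.component n)
                      (injective (proj₂ 𝒜.union (n , c′)) (proj₂ 𝒜.union (m , c))
                        (trans eq′ (sym eq))) c′) }
  ; union     = (λ t → let x , s , eq = onto t ; n , c = proj₁ 𝒜.union s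
                       in n , x , c , eq)
              , (λ { (n , x , c , eq) → subst T eq (into (proj₂ 𝒜.union (n , c))) })
  }
  where
  module 𝒜 = Arrangement 𝒜
  module 𝒜ᶠ n = Enumeration (𝒜.finite n)

  map-unique : ∀ {xs} → All S xs → Unique xs → Unique (map f xs)
  map-unique []       []         = []
  map-unique (s ∷ ss) (≢s ∷ uxs) =
    All.map⁺ (All.zipWith (λ { (s′ , ≢) → ≢ ∘ injective s s′ }) (ss , ≢s))
    ∷ map-unique ss uxs

ℚ⁺ : Pred ℚ 0ℓ
ℚ⁺ q = 0ℚ ℚ.< q

-- On ℕ₀ × 𝕀 this is the mixed fraction (p , k/m) ↦ p + k/m.
mixed : ℕ × ℚ → ℚ
mixed (p , q) = fromℕ p ℚ.+ q

fromℕ-mono-≤ : ∀ {m n} → m ℕ.≤ n → fromℕ m ℚ.≤ fromℕ n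
fromℕ-mono-≤ {m} {n} m≤n
  rewrite ℚ.normalize-coprime (coprime-sym (1-coprimeTo m))
        | ℚ.normalize-coprime (coprime-sym (1-coprimeTo n))
  = *≤* (subst₂ ℤ._≤_ (sym (ℤ.*-identityʳ _)) (sym (ℤ.*-identityʳ _)) (ℤ.+≤+ m≤n))

fromℕ-suc : ∀ n → fromℕ (suc n) ≡ fromℕ n ℚ.+ 1ℚ
fromℕ-suc n = ℚ.toℚᵘ-injective (begin
  ℚ.toℚᵘ (fromℕ (suc n))              ≈⟨ ℚ.toℚᵘ-fromℚᵘ (mkℚᵘ (+ suc n) 0) ⟩
  mkℚᵘ (+ suc n) 0                    ≈⟨ *≡* (cong (ℤ._* + 1) lemma) ⟩
  mkℚᵘ (+ n) 0 ℚᵘ.+ ℚ.toℚᵘ 1ℚ         ≈⟨ ℚᵘ.+-congˡ (ℚ.toℚᵘ 1ℚ)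
                                          (ℚᵘ.≃-sym (ℚ.toℚᵘ-fromℚᵘ (mkℚᵘ (+ n) 0))) ⟩
  ℚ.toℚᵘ (fromℕ n) ℚᵘ.+ ℚ.toℚᵘ 1ℚ     ≈⟨ ℚᵘ.≃-sym (ℚ.toℚᵘ-homo-+ (fromℕ n) 1ℚ) ⟩
  ℚ.toℚᵘ (fromℕ n ℚ.+ 1ℚ)             ∎)
  where
  open import Data.Rational.Unnormalised.Base using (*≡*)
  import Data.Rational.Unnormalised.Base as ℚᵘ
  import Data.Rational.Unnormalised.Properties as ℚᵘ
  open ℚᵘ.≃-Reasoning
  lemma : + suc n ≡ + n ℤ.* + 1 ℤ.+ + 1
  lemma = trans (cong +_ (ℕ.+-comm 1 n)) (cong (ℤ._+ + 1) (sym (ℤ.*-identityʳ (+ n))))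

mixed-positive : ∀ {x} → (U ⟨×⟩ 𝕀) x → ℚ⁺ (mixed x)
mixed-positive {p , q} (_ , 0<q , _) = ℚ.+-mono-≤-< (fromℕ-mono-≤ {0} {p} z≤n) 0<q

mixed-mono : ∀ {p p′ q q′} → 𝕀 q → 𝕀 q′ → p ℕ.< p′ → mixed (p , q) ℚ.< mixed (p′ , q′)
mixed-mono {p} {p′} {q} {q′} (_ , q≤1) (0<q′ , _) p<p′ = begin-strict
  fromℕ p ℚ.+ q    ≤⟨ ℚ.+-monoʳ-≤ (fromℕ p) q≤1 ⟩
  fromℕ p ℚ.+ 1ℚ   ≡⟨ fromℕ-suc p ⟨
  fromℕ (suc p)    ≤⟨ fromℕ-mono-≤ p<p′ ⟩
  fromℕ p′         ≡⟨ ℚ.+-identityʳ (fromℕ p′) ⟨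
  fromℕ p′ ℚ.+ 0ℚ  <⟨ ℚ.+-monoʳ-< (fromℕ p′) 0<q′ ⟩
  fromℕ p′ ℚ.+ q′  ∎
  where open ℚ.≤-Reasoning

mixed-injective : ∀ {x y} → (U ⟨×⟩ 𝕀) x → (U ⟨×⟩ 𝕀) y → mixed x ≡ mixed y → x ≡ y
mixed-injective {p , q} {p′ , q′} (_ , i) (_ , i′) eq with ℕ.<-cmp p p′
... | tri< p<p′ _ _ = contradiction eq (ℚ.<⇒≢ (mixed-mono i i′ p<p′))
... | tri> _ _ p′<p = contradiction (sym eq) (ℚ.<⇒≢ (mixed-mono i′ i p′<p))
... | tri≈ _ refl _ = cong (p ,_) (+-cancelˡ (fromℕ p) q q′ eq)
  where open import Algebra.Properties.Group ℚ.+-0-group renaming (∙-cancelˡ to +-cancelˡ)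

mixed-surjective : ∀ {q} → ℚ⁺ q → ∃ λ x → (U ⟨×⟩ 𝕀) x × mixed x ≡ q
mixed-surjective {q} 0<q = go ℤ.∣ ℚ.↥ q ∣ q 0<q (bound q)
  where
  bound : ∀ q → q ℚ.≤ fromℕ ℤ.∣ ℚ.↥ q ∣
  bound (mkℚ (+ k) d-1 c)
    rewrite ℚ.normalize-coprime (coprime-sym (1-coprimeTo k))
    = *≤* (ℤ.*-monoˡ-≤-nonNeg (+ k) (ℤ.+≤+ (s≤s z≤n)))
  bound q@(mkℚ ℤ.-[1+ k ] d-1 c) =
    ℚ.≤-trans (ℚ.<⇒≤ (ℚ.negative⁻¹ q)) (fromℕ-mono-≤ {0} {suc k} z≤n)

  cancel : ∀ q → (q ℚ.- 1ℚ) ℚ.+ 1ℚ ≡ q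
  cancel q = trans (ℚ.+-assoc q (ℚ.- 1ℚ) 1ℚ) (ℚ.+-identityʳ q)

  go : ∀ n q → 0ℚ ℚ.< q → q ℚ.≤ fromℕ n → ∃ λ x → (U ⟨×⟩ 𝕀) x × mixed x ≡ q
  go zero    q 0<q q≤0 = contradiction (ℚ.<-≤-trans 0<q q≤0) (ℚ.<-irrefl refl)
  go (suc n) q 0<q q≤n with q ℚ.≤? 1ℚ
  ... | yes q≤1 = (0 , q) , (_ , 0<q , q≤1) , ℚ.+-identityˡ q
  ... | no  q≰1 with go n (q ℚ.- 1ℚ) (ℚ.+-monoˡ-< (ℚ.- 1ℚ) (ℚ.≰⇒> q≰1))
                     (subst (q ℚ.- 1ℚ ℚ.≤_) (eq n) (ℚ.+-monoˡ-≤ (ℚ.- 1ℚ) q≤n))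
    where
    eq : ∀ n → fromℕ (suc n) ℚ.- 1ℚ ≡ fromℕ n
    eq n = trans (cong (ℚ._- 1ℚ) (fromℕ-suc n))
             (trans (ℚ.+-assoc (fromℕ n) 1ℚ (ℚ.- 1ℚ)) (ℚ.+-identityʳ (fromℕ n)))
  ... | (p , r) , s , eq = (suc p , r) , s , (begin
    fromℕ (suc p) ℚ.+ r         ≡⟨ cong (ℚ._+ r) (fromℕ-suc p) ⟩
    fromℕ p ℚ.+ 1ℚ ℚ.+ r        ≡⟨ ℚ.+-assoc (fromℕ p) 1ℚ r ⟩
    fromℕ p ℚ.+ (1ℚ ℚ.+ r)      ≡⟨ cong (fromℕ p ℚ.+_) (ℚ.+-comm 1ℚ r) ⟩
    fromℕ p ℚ.+ (r ℚ.+ 1ℚ)      ≡⟨ ℚ.+-assoc (fromℕ p) r 1ℚ ⟨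
    fromℕ p ℚ.+ r ℚ.+ 1ℚ        ≡⟨ cong (ℚ._+ 1ℚ) eq ⟩
    q ℚ.- 1ℚ ℚ.+ 1ℚ             ≡⟨ cancel q ⟩
    q                           ∎)
    where open ≡-Reasoning

-- The n-th component consists of the p + k/m with (k , m) in lowest terms and
-- max{ℓ(p), m} = n, where ℓ(0) = 1 and ℓ(p) = p for p ≥ 1.
ℚ⁺-arrangement : Arrangement ℚ⁺
ℚ⁺-arrangement = transport mixed
  (λ {x} → mixed-positive {x}) mixed-injective mixed-surjective
  (ℕ₀-arrangement ⊗ 𝕀-arrangement)

{-# OPTIONS --safe #-}

-- The pairs (i , j) with max{i , j} ≤ n form the square i ≤ n, j ≤ n, so sizes multiply on
-- products. Hence σₙ(ℚ⁺) = (n + 1) Φ(n), leaving 3/10 n² < Φ(n) < n(n - 1)/2 for large n.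
--
-- Sorting the pairs k ≤ m ≤ n by their gcd gives T(n) := n(n + 1)/2 = Σ_d Φ(n/d), with n/d rounded
-- down. Sieving out the multiples of 2 and 3,
--   T(n) + T(n/6) - T(n/2) - T(n/3) = Φ(n) + A(n),  A(n) = Σ Φ(n/m) over m > 1 prime to 6,
-- and the left side is n²/3 + O(n). Dropping A(n) yields Φ(n) ≤ n²/3 + O(n). Inserting this bound
-- into A(n) yields Φ(n) ≥ n²/3 (1 - Σ 1/m²) - O(n), and already Σ 1/m² < 1/10:
-- 1/5² + 1/7² + 1/27 < 0.0975, where 1/27 bounds the telescoping tail of the remaining m = 6k ± 1.

module Submission where

open import Defs hiding (_+_; _-_; _*_; _^_)
open import Data.List.Base
  using (List; []; _∷_; _++_; _∷ʳ_; map; filter; length; applyUpTo; cartesianProduct)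
open import Data.List.Properties using (applyUpTo-∷ʳ; filter-++; length-++; length-map)
open import Data.List.Membership.Propositional.Properties
  using (∈-++⁺ˡ; ∈-++⁺ʳ; ∈-++⁻; ∈-cartesianProduct⁺; ∈-cartesianProduct⁻)
open import Data.List.Membership.Propositional.Properties.WithK using (unique∧set⇒bag)
open import Data.List.Relation.Binary.BagAndSetEquality using (∼bag⇒↭)
open import Data.List.Relation.Binary.Permutation.Propositional.Properties using (↭-length)
open import Data.List.Relation.Unary.AllPairs using ([])
import Data.List.Relation.Unary.Unique.Propositional.Properties as Unique
open import Data.Nat.Base using (ℕ; zero; suc; pred; _≥_; _≤_; _<_; z≤n; s≤s; NonZero)
import Data.Nat.Base as ℕ
import Data.Nat.Properties as ℕ
open import Data.Nat.Coprimality using (coprime?; coprime⇒gcd≡1; gcd≡1⇒coprime)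
open import Data.Nat.Divisibility using (_∣_; ∣⇒≤; ∣m+n∣m⇒∣n; n∣m*n)
open import Data.Nat.DivMod
  using (m≡m%n+[m/n]*n; m%n<n; m/n/o≡m/[n*o]; m*n/n≡m; m/n≤m; m/n*n≤m; n/1≡n)
open import Data.Nat.GCD
  using (gcd; gcd[m,n]∣m; gcd[m,n]∣n; gcd[m,n]≤n; gcd[m,n]≢0; c*gcd[m,n]≡gcd[cm,cn])
open import Data.Nat.Tactic.RingSolver using (solve-∀)
open import Data.Product.Base using (∃; _×_; _,_)
open import Data.Rational.Base using (0ℚ; 1ℚ; ½)
import Data.Rational.Base as ℚ
import Data.Rational.Properties as ℚ
open import Data.Sum.Base using (inj₁; inj₂)
open import Function.Base using (_∘_)
open import Function.Bundles using (mk⇔)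
open import Level using (0ℓ)
open import Relation.Binary.PropositionalEquality
  using (_≡_; refl; sym; trans; cong; cong₂; subst; subst₂; module ≡-Reasoning)
open import Relation.Nullary using (¬_; Dec; yes; no; contradiction)
open import Relation.Unary using (Pred; Decidable; _≐_; _⟨×⟩_)

module Counting where

  open import Data.Nat.Base using (_+_; _*_; _%_; _/_)

  -- Finite sums.

  ∑-cong : ∀ n {f g} → (∀ i → 1 ≤ i → i ≤ n → f i ≡ g i) → ∑₁ n f ≡ ∑₁ n g
  ∑-cong zero    eq = refl
  ∑-cong (suc n) eq = cong₂ _+_
    (∑-cong n λ i 1≤i i≤n → eq i 1≤i (ℕ.m≤n⇒m≤1+n i≤n)) (eq (suc n) (s≤s z≤n) ℕ.≤-refl)

  ∑-mono : ∀ n {f g} → (∀ i → 1 ≤ i → f i ≤ g i) → ∑₁ n f ≤ ∑₁ n g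
  ∑-mono zero    le = z≤n
  ∑-mono (suc n) le = ℕ.+-mono-≤ (∑-mono n le) (le (suc n) (s≤s z≤n))

  ∑-+ : ∀ n f g → ∑₁ n (λ i → f i + g i) ≡ ∑₁ n f + ∑₁ n g
  ∑-+ zero    f g = refl
  ∑-+ (suc n) f g rewrite ∑-+ n f g = interchange (∑₁ n f) (∑₁ n g) (f (suc n)) (g (suc n))
    where
    interchange : ∀ a b c d → a + b + (c + d) ≡ a + c + (b + d)
    interchange = solve-∀

  ∑-const : ∀ n c → ∑₁ n (λ _ → c) ≡ n * c
  ∑-const zero    c = refl
  ∑-const (suc n) c = trans (cong (_+ c) (∑-const n c)) (ℕ.+-comm (n * c) c)

  ∑-* : ∀ n c f → ∑₁ n (λ i → c * f i) ≡ c * ∑₁ n f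
  ∑-* zero    c f = sym (ℕ.*-zeroʳ c)
  ∑-* (suc n) c f = trans (cong (_+ c * f (suc n)) (∑-* n c f))
                          (sym (ℕ.*-distribˡ-+ c (∑₁ n f) (f (suc n))))

  ∑-zero : ∀ n {f} → (∀ i → 1 ≤ i → i ≤ n → f i ≡ 0) → ∑₁ n f ≡ 0
  ∑-zero n eq = trans (∑-cong n eq) (trans (∑-const n 0) (ℕ.*-zeroʳ n))

  ∑-swap : ∀ m n (f : ℕ → ℕ → ℕ) →
           ∑₁ m (λ i → ∑₁ n λ j → f i j) ≡ ∑₁ n (λ j → ∑₁ m λ i → f i j)
  ∑-swap zero    n f = sym (∑-zero n λ _ _ _ → refl)
  ∑-swap (suc m) n f = trans (cong (_+ ∑₁ n (f (suc m))) (∑-swap m n f))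
                             (sym (∑-+ n (λ j → ∑₁ m λ i → f i j) (f (suc m))))

  ∑-split : ∀ m n f → ∑₁ (m + n) f ≡ ∑₁ m f + ∑₁ n (λ i → f (m + i))
  ∑-split m zero    f rewrite ℕ.+-identityʳ m = sym (ℕ.+-identityʳ _)
  ∑-split m (suc n) f rewrite ℕ.+-suc m n =
    trans (cong (_+ f (suc (m + n))) (∑-split m n f)) (ℕ.+-assoc (∑₁ m f) _ _)

  -- Cut the range into n/d blocks of length d and a remainder shorter than d. Only the last index
  -- of each block is a multiple of d, and the remainder contains none.
  ∑-multiples : ∀ d .{{_ : NonZero d}} {h : ℕ → ℕ} → (∀ i → ¬ d ∣ i → h i ≡ 0) →
                ∀ n → ∑₁ n h ≡ ∑₁ (n / d) (λ j → h (j * d))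
  ∑-multiples d@(suc d-1) {h} vanish n = begin
    ∑₁ n h                                           ≡⟨ cong (λ m → ∑₁ m h) n≡ ⟩
    ∑₁ (q * d + r) h                                 ≡⟨ ∑-split (q * d) r h ⟩
    ∑₁ (q * d) h + ∑₁ r (λ i → h (q * d + i))        ≡⟨ cong (∑₁ (q * d) h +_) (between q r (m%n<n n d)) ⟩
    ∑₁ (q * d) h + 0                                 ≡⟨ ℕ.+-identityʳ _ ⟩
    ∑₁ (q * d) h                                     ≡⟨ blocks q ⟩
    ∑₁ q (λ j → h (j * d))                           ∎
    where
    open ≡-Reasoning
    q = n / d
    r = n % d
    n≡ : n ≡ q * d + r
    n≡ = trans (m≡m%n+[m/n]*n n d) (ℕ.+-comm r (q * d))

    between : ∀ j r → r < d → ∑₁ r (λ i → h (j * d + i)) ≡ 0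
    between j r r<d = ∑-zero r λ where
      i@(suc _) _ i≤r → vanish _ λ d∣ →
        ℕ.<⇒≱ (ℕ.≤-<-trans i≤r r<d) (∣⇒≤ (∣m+n∣m⇒∣n d∣ (n∣m*n j)))

    blocks : ∀ q → ∑₁ (q * d) h ≡ ∑₁ q (λ j → h (j * d))
    blocks zero    = refl
    blocks (suc q) = begin
      ∑₁ (d + q * d) h                                           ≡⟨ cong (λ m → ∑₁ m h) (ℕ.+-comm d (q * d)) ⟩
      ∑₁ (q * d + d) h                                           ≡⟨ ∑-split (q * d) d h ⟩
      ∑₁ (q * d) h + (∑₁ d-1 (λ i → h (q * d + i)) + h (q * d + d))
        ≡⟨ cong₂ (λ a b → a + (b + h (q * d + d))) (blocks q) (between q d-1 ℕ.≤-refl) ⟩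
      ∑₁ q (λ j → h (j * d)) + h (q * d + d)
        ≡⟨ cong (λ m → ∑₁ q (λ j → h (j * d)) + h m) (ℕ.+-comm (q * d) d) ⟩
      ∑₁ q (λ j → h (j * d)) + h (d + q * d)                     ∎

  -- Indicators, and counting pairs by their gcd.

  𝟙 : {P : Set} → Dec P → ℕ
  𝟙 (yes _) = 1
  𝟙 (no _)  = 0

  𝟙-cong : {P Q : Set} (P? : Dec P) (Q? : Dec Q) → (P → Q) → (Q → P) → 𝟙 P? ≡ 𝟙 Q?
  𝟙-cong (yes p) (yes q) _ _ = refl
  𝟙-cong (yes p) (no ¬q) f _ = contradiction (f p) ¬q
  𝟙-cong (no ¬p) (yes q) _ g = contradiction (g q) ¬p
  𝟙-cong (no ¬p) (no ¬q) _ _ = refl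

  𝟙-no : {P : Set} (P? : Dec P) → ¬ P → 𝟙 P? ≡ 0
  𝟙-no (yes p) ¬p = contradiction p ¬p
  𝟙-no (no _)  _  = refl

  -- The recursion peels off the last element, as `∑₁` does; `pred` reconciles sums starting at 1
  -- with lists indexed from 0.
  length-filter-applyUpTo : {A : Set} {P : Pred A 0ℓ} (P? : Decidable P) (f : ℕ → A) (n : ℕ) →
    length (filter P? (applyUpTo f n)) ≡ ∑₁ n (λ i → 𝟙 (P? (f (pred i))))
  length-filter-applyUpTo P? f zero    = refl
  length-filter-applyUpTo P? f (suc n) = begin
    length (filter P? (applyUpTo f (suc n)))
      ≡⟨ cong (length ∘ filter P?) (applyUpTo-∷ʳ f n) ⟨
    length (filter P? (applyUpTo f n ∷ʳ f n))
      ≡⟨ cong length (filter-++ P? (applyUpTo f n) (f n ∷ [])) ⟩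
    length (filter P? (applyUpTo f n) ++ filter P? (f n ∷ []))
      ≡⟨ length-++ (filter P? (applyUpTo f n)) ⟩
    length (filter P? (applyUpTo f n)) + length (filter P? (f n ∷ []))
      ≡⟨ cong₂ _+_ (length-filter-applyUpTo P? f n) (singleton (f n)) ⟩
    ∑₁ n (λ i → 𝟙 (P? (f (pred i)))) + 𝟙 (P? (f n)) ∎
    where
    open ≡-Reasoning
    singleton : ∀ x → length (filter P? (x ∷ [])) ≡ 𝟙 (P? x)
    singleton x with P? x
    ... | yes _ = refl
    ... | no  _ = refl

  -- Ensures that sorting by gcd counts each pair exactly once.
  ∑-𝟙-≡ : ∀ {g} n → 1 ≤ g → g ≤ n → ∑₁ n (λ d → 𝟙 (g ℕ.≟ d)) ≡ 1
  ∑-𝟙-≡ {suc g} zero 1≤g ()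
  ∑-𝟙-≡ {g} (suc n) 1≤g g≤1+n with g ℕ.≟ suc n
  ... | yes refl = cong (_+ 1) (∑-zero n λ d _ d≤n → 𝟙-no (suc n ℕ.≟ d) λ eq → ℕ.<⇒≢ (s≤s d≤n) (sym eq))
  ... | no g≢1+n = trans (ℕ.+-identityʳ _) (∑-𝟙-≡ n 1≤g (ℕ.≤-pred (ℕ.≤∧≢⇒< g≤1+n g≢1+n)))

  -- Restates coprimality through `gcd`, whose scaling law then reduces gcd d to gcd 1.
  φ-as-sum : ∀ n → φ n ≡ ∑₁ n (λ k → 𝟙 (gcd k n ℕ.≟ 1))
  φ-as-sum n = trans (length-filter-applyUpTo (λ k → coprime? k n) suc n) (∑-cong n λ where
      (suc k) _ _ → 𝟙-cong (coprime? (suc k) n) (gcd (suc k) n ℕ.≟ 1) coprime⇒gcd≡1 gcd≡1⇒coprime)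

  -- Division made total by n ÷ 0 = 0, so that sums over the divisor need no side conditions.
  infixl 7 _÷_
  _÷_ : ℕ → ℕ → ℕ
  n ÷ zero      = 0
  n ÷ d@(suc _) = n / d

  ÷-÷ : ∀ n a b → n ÷ (a * b) ≡ n ÷ a ÷ b
  ÷-÷ n zero    zero    = refl
  ÷-÷ n zero    (suc b) = refl
  ÷-÷ n (suc a) zero    rewrite ℕ.*-zeroʳ a = refl
  ÷-÷ n (suc a) (suc b) = sym (m/n/o≡m/[n*o] n (suc a) (suc b))

  -- The pairs k ≤ m ≤ n with gcd k m = d are the d-multiples of the coprime pairs k ≤ m ≤ n/d.
  count-gcd≡ : ∀ n d .{{_ : NonZero d}} →
               ∑₁ n (λ m → ∑₁ m λ k → 𝟙 (gcd k m ℕ.≟ d)) ≡ Φ (n ÷ d)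
  count-gcd≡ n d@(suc _) = begin
    ∑₁ n (λ m → ∑₁ m λ k → 𝟙 (gcd k m ℕ.≟ d))
      ≡⟨ ∑-multiples d (λ m d∤m → ∑-zero m λ k _ _ → 𝟙-no (gcd k m ℕ.≟ d) λ eq →
           d∤m (subst (_∣ m) eq (gcd[m,n]∣n k m))) n ⟩
    ∑₁ (n / d) (λ m → ∑₁ (m * d) λ k → 𝟙 (gcd k (m * d) ℕ.≟ d))
      ≡⟨ ∑-cong (n / d) (λ m _ _ → row m) ⟩
    Φ (n / d) ∎
    where
    open ≡-Reasoning
    scale : ∀ k m → d * gcd k m ≡ gcd (k * d) (m * d)
    scale k m = trans (c*gcd[m,n]≡gcd[cm,cn] d k m) (cong₂ gcd (ℕ.*-comm d k) (ℕ.*-comm d m))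

    row : ∀ m → ∑₁ (m * d) (λ k → 𝟙 (gcd k (m * d) ℕ.≟ d)) ≡ φ m
    row m = begin
      ∑₁ (m * d) (λ k → 𝟙 (gcd k (m * d) ℕ.≟ d))
        ≡⟨ ∑-multiples d (λ k d∤k → 𝟙-no (gcd k (m * d) ℕ.≟ d) λ eq →
             d∤k (subst (_∣ k) eq (gcd[m,n]∣m k (m * d)))) (m * d) ⟩
      ∑₁ (m * d / d) (λ k → 𝟙 (gcd (k * d) (m * d) ℕ.≟ d))
        ≡⟨ cong (λ q → ∑₁ q (λ k → 𝟙 (gcd (k * d) (m * d) ℕ.≟ d))) (m*n/n≡m m d) ⟩
      ∑₁ m (λ k → 𝟙 (gcd (k * d) (m * d) ℕ.≟ d))
        ≡⟨ ∑-cong m (λ k _ _ → 𝟙-cong (gcd (k * d) (m * d) ℕ.≟ d) (gcd k m ℕ.≟ 1)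
             (λ eq → ℕ.*-cancelˡ-≡ _ 1 d (trans (scale k m) (trans eq (sym (ℕ.*-identityʳ d)))))
             (λ eq → trans (sym (scale k m)) (trans (cong (d *_) eq) (ℕ.*-identityʳ d)))) ⟩
      ∑₁ m (λ k → 𝟙 (gcd k m ℕ.≟ 1))
        ≡⟨ φ-as-sum m ⟨
      φ m ∎

  T : ℕ → ℕ
  T n = ∑₁ n λ m → m

  2*T : ∀ n → 2 * T n ≡ n * (n + 1)
  2*T zero    = refl
  2*T (suc n) = trans (ℕ.*-distribˡ-+ 2 (T n) (suc n)) (trans (cong (_+ 2 * suc n) (2*T n)) (eq n))
    where
    eq : ∀ n → n * (n + 1) + 2 * suc n ≡ suc n * (suc n + 1)
    eq = solve-∀

  -- Each m is a sum of m ones, each one is spread over the possible values d of `gcd k m`, and the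
  -- sums are interchanged. Terms with d > n are `Φ 0`, so any limit N from n on will do; the sieve
  -- uses this freedom to align ranges.
  T≡∑Φ : ∀ {n N} → n ≤ N → T n ≡ ∑₁ N (λ d → Φ (n ÷ d))
  T≡∑Φ {n} {N} n≤N = begin
    ∑₁ n (λ m → m)
      ≡⟨ ∑-cong n (λ m 1≤m m≤n → trans (sym (trans (∑-const m 1) (ℕ.*-identityʳ m)))
           (∑-cong m λ k 1≤k _ → sym (∑-𝟙-≡ N (gcd≥1 k m 1≤k) (gcd≤ k m 1≤m m≤n)))) ⟩
    ∑₁ n (λ m → ∑₁ m λ k → ∑₁ N λ d → 𝟙 (gcd k m ℕ.≟ d))
      ≡⟨ ∑-cong n (λ m _ _ → ∑-swap m N λ k d → 𝟙 (gcd k m ℕ.≟ d)) ⟩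
    ∑₁ n (λ m → ∑₁ N λ d → ∑₁ m λ k → 𝟙 (gcd k m ℕ.≟ d))
      ≡⟨ ∑-swap n N (λ m d → ∑₁ m λ k → 𝟙 (gcd k m ℕ.≟ d)) ⟩
    ∑₁ N (λ d → ∑₁ n λ m → ∑₁ m λ k → 𝟙 (gcd k m ℕ.≟ d))
      ≡⟨ ∑-cong N (λ { d@(suc _) _ _ → count-gcd≡ n d }) ⟩
    ∑₁ N (λ d → Φ (n ÷ d)) ∎
    where
    open ≡-Reasoning
    gcd≥1 : ∀ k m → 1 ≤ k → 1 ≤ gcd k m
    gcd≥1 (suc k) m _ = ℕ.n≢0⇒n>0 (gcd[m,n]≢0 (suc k) m (inj₁ λ ()))
    gcd≤ : ∀ k m → 1 ≤ m → m ≤ n → gcd k m ≤ N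
    gcd≤ k m@(suc _) _ m≤n = ℕ.≤-trans (gcd[m,n]≤n k m) (ℕ.≤-trans m≤n n≤N)

  -- The sieve by 2 and 3.

  -- Inclusion-exclusion on 1, ..., 6N + 1: the multiples of 2 and of 3 both cover the multiples of
  -- 6, which the second sum on the left compensates; what remains is 1 and the 6k ± 1. The
  -- induction appends the six indices 6N + 2, ..., 6N + 7.
  sieve-6 : ∀ f N →
    ∑₁ (suc (N * 6)) f + ∑₁ N (λ k → f (k * 6))
    ≡ f 1 + ∑₁ N (λ k → f (pred (k * 6)) + f (suc (k * 6)))
      + (∑₁ (N * 3) (λ k → f (k * 2)) + ∑₁ (N * 2) (λ k → f (k * 3)))
  sieve-6 f zero    = sym (ℕ.+-identityʳ (f 1 + 0))
  sieve-6 f (suc N)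
    -- The new multiples of 2 and 3 are offset by `N * 3 * 2` and `N * 2 * 3`; both are brought to
    -- the offset `N * 6` of the left side.
    rewrite ℕ.*-assoc N 3 2 | ℕ.*-assoc N 2 3
    = trans (shuffleˡ (∑₁ (suc (N * 6)) f) (∑₁ N λ k → f (k * 6)) (F 2) (F 3) (F 4) (F 5) (F 6) (F 7))
            (trans (cong (_+ (F 2 + F 3 + F 4 + F 5 + 2 * F 6 + F 7)) (sieve-6 f N))
                   (shuffleʳ (f 1) _ (∑₁ (N * 3) λ k → f (k * 2)) (∑₁ (N * 2) λ k → f (k * 3))
                     (F 2) (F 3) (F 4) (F 5) (F 6) (F 7)))
    where
    F : ℕ → ℕ
    F i = f (i + N * 6)
    shuffleˡ : ∀ a b f₂ f₃ f₄ f₅ f₆ f₇ →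
      a + f₂ + f₃ + f₄ + f₅ + f₆ + f₇ + (b + f₆)
      ≡ a + b + (f₂ + f₃ + f₄ + f₅ + 2 * f₆ + f₇)
    shuffleˡ = solve-∀
    shuffleʳ : ∀ f₁ c b a f₂ f₃ f₄ f₅ f₆ f₇ →
      f₁ + c + (b + a) + (f₂ + f₃ + f₄ + f₅ + 2 * f₆ + f₇)
      ≡ f₁ + (c + (f₅ + f₇)) + (b + f₂ + f₄ + f₆ + (a + f₃ + f₆))
    shuffleʳ = solve-∀

  -- The m > 1 prime to 6 are the 6k ± 1; those with m > n contribute Φ 0 = 0.
  A : ℕ → ℕ
  A n = ∑₁ n (λ k → Φ (n ÷ pred (k * 6)) + Φ (n ÷ suc (k * 6)))

  -- `sieve-6` for d ↦ `Φ (n ÷ d)`, up to 6n + 1: a limit of the required shape that lies beyond n.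
  -- Its term at d = 1 is `Φ n`.
  Φ-sieved : ∀ n → T n + T (n / 6) ≡ Φ n + A n + (T (n / 2) + T (n / 3))
  Φ-sieved n = begin
    T n + T (n / 6)
      ≡⟨ cong₂ _+_ (T≡∑Φ {N = suc (n * 6)} (ℕ.≤-trans (ℕ.m≤m*n n 6) (ℕ.n≤1+n _))) (part 6 n (m/n≤m n 6)) ⟩
    ∑₁ (suc (n * 6)) f + ∑₁ n (λ k → f (k * 6))
      ≡⟨ sieve-6 f n ⟩
    f 1 + A n + (∑₁ (n * 3) (λ k → f (k * 2)) + ∑₁ (n * 2) (λ k → f (k * 3)))
      ≡⟨ cong₂ (λ a b → a + A n + b) (cong Φ (n/1≡n n))
           (cong₂ _+_ (sym (part 2 (n * 3) (ℕ.≤-trans (m/n≤m n 2) (ℕ.m≤m*n n 3))))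
                      (sym (part 3 (n * 2) (ℕ.≤-trans (m/n≤m n 3) (ℕ.m≤m*n n 2))))) ⟩
    Φ n + A n + (T (n / 2) + T (n / 3)) ∎
    where
    open ≡-Reasoning
    f : ℕ → ℕ
    f d = Φ (n ÷ d)
    -- Since n ÷ (ka) is (n / a) ÷ k, the multiples of a among the divisors reproduce the gcd count
    -- for n / a.
    part : ∀ a N .{{_ : NonZero a}} → n / a ≤ N → T (n / a) ≡ ∑₁ N (λ k → f (k * a))
    part a@(suc _) N le = trans (T≡∑Φ le)
      (∑-cong N λ k _ _ → cong Φ (sym (trans (cong (n ÷_) (ℕ.*-comm k a)) (÷-÷ n a k))))

  -- Sizes of arrangements.

  private
    variable
      X Y : Set

  open Enumeration
  open Arrangement

  -- Duplicate-free lists with the same members are permutations of each other.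
  cardinality-cong : {P Q : Pred X 0ℓ} (E : Enumeration P) (F : Enumeration Q) →
                     P ≐ Q → cardinality E ≡ cardinality F
  cardinality-cong E F (P⊆Q , Q⊆P) = ↭-length (∼bag⇒↭ (unique∧set⇒bag (unique E) (unique F)
    (mk⇔ (λ x∈ → complete F (P⊆Q (sound E x∈))) (λ x∈ → complete E (Q⊆P (sound F x∈))))))

  length-cartesianProduct : (xs : List X) (ys : List Y) →
    length (cartesianProduct xs ys) ≡ length xs * length ys
  length-cartesianProduct []       ys = refl
  length-cartesianProduct (x ∷ xs) ys = trans (length-++ (map (x ,_) ys))
    (cong₂ _+_ (length-map (x ,_) ys) (length-cartesianProduct xs ys))

  product : {P : Pred X 0ℓ} {Q : Pred Y 0ℓ} →
            Enumeration P → Enumeration Q → Enumeration (P ⟨×⟩ Q)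
  product E F = record
    { elements = cartesianProduct (elements E) (elements F)
    ; unique   = Unique.cartesianProduct⁺ (unique E) (unique F)
    ; sound    = λ xy∈ → let x∈ , y∈ = ∈-cartesianProduct⁻ (elements E) (elements F) xy∈
                         in sound E x∈ , sound F y∈
    ; complete = λ { (p , q) → ∈-cartesianProduct⁺ (complete E p) (complete F q) }
    }

  -- Turns a cumulative size into the cardinality of a single predicate, so that `cardinality-cong`
  -- can compare sizes.
  Initial : {S : Pred X 0ℓ} → Arrangement S → ℕ → Pred X 0ℓ
  Initial 𝒜 n x = ∃ λ i → i ≤ n × component 𝒜 i x

  initial : {S : Pred X 0ℓ} (𝒜 : Arrangement S) (n : ℕ) → Enumeration (Initial 𝒜 n)
  initial 𝒜 zero = record
    { elements = []
    ; unique   = []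
    ; sound    = λ ()
    -- Only the dummy index 0 remains, and its component is empty.
    ; complete = λ { (zero , _ , a) → contradiction a (empty₀ 𝒜 _) }
    }
  initial 𝒜 (suc n) = record
    { elements = elements (initial 𝒜 n) ++ elements (finite 𝒜 (suc n))
    ; unique   = Unique.++⁺ (unique (initial 𝒜 n)) (unique (finite 𝒜 (suc n))) λ (x∈ , x∈′) →
        let i , i≤n , a = sound (initial 𝒜 n) x∈
        in ℕ.<⇒≢ (s≤s i≤n) (disjoint 𝒜 a (sound (finite 𝒜 (suc n)) x∈′))
    ; sound    = λ x∈ → case-sound (∈-++⁻ (elements (initial 𝒜 n)) x∈)
    ; complete = λ (i , i≤1+n , a) → case-complete i a (ℕ.m≤n⇒m<n∨m≡n i≤1+n)
    }
    where
    case-sound : ∀ {x} → _ → Initial 𝒜 (suc n) x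
    case-sound (inj₁ x∈) = let i , i≤n , a = sound (initial 𝒜 n) x∈ in i , ℕ.m≤n⇒m≤1+n i≤n , a
    case-sound (inj₂ x∈) = suc n , ℕ.≤-refl , sound (finite 𝒜 (suc n)) x∈

    case-complete : ∀ {x} i → component 𝒜 i x → _ → _
    case-complete i a (inj₁ i<1+n) = ∈-++⁺ˡ (complete (initial 𝒜 n) (i , ℕ.≤-pred i<1+n , a))
    case-complete i a (inj₂ refl)  = ∈-++⁺ʳ (elements (initial 𝒜 n)) (complete (finite 𝒜 (suc n)) a)

  cardinality-initial : {S : Pred X 0ℓ} (𝒜 : Arrangement S) (n : ℕ) →
                        cardinality (initial 𝒜 n) ≡ size 𝒜 n
  cardinality-initial 𝒜 zero    = refl
  cardinality-initial 𝒜 (suc n) = trans (length-++ (elements (initial 𝒜 n)))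
    (cong (_+ cardinality (finite 𝒜 (suc n))) (cardinality-initial 𝒜 n))

  -- Both sides enumerate the same predicate, as max{i, j} ≤ n exactly when i ≤ n and j ≤ n; the
  -- L-shaped layers max{i, j} = n are never counted separately.
  size-⊗ : {S : Pred X 0ℓ} {R : Pred Y 0ℓ} (𝒜 : Arrangement S) (ℬ : Arrangement R) (n : ℕ) →
           size (𝒜 ⊗ ℬ) n ≡ size 𝒜 n * size ℬ n
  size-⊗ 𝒜 ℬ n = begin
    size (𝒜 ⊗ ℬ) n                                    ≡⟨ cardinality-initial (𝒜 ⊗ ℬ) n ⟨
    cardinality (initial (𝒜 ⊗ ℬ) n)
      ≡⟨ cardinality-cong (initial (𝒜 ⊗ ℬ) n) (product (initial 𝒜 n) (initial ℬ n)) (to , from) ⟩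
    cardinality (product (initial 𝒜 n) (initial ℬ n))
      ≡⟨ length-cartesianProduct (elements (initial 𝒜 n)) (elements (initial ℬ n)) ⟩
    cardinality (initial 𝒜 n) * cardinality (initial ℬ n)
      ≡⟨ cong₂ _*_ (cardinality-initial 𝒜 n) (cardinality-initial ℬ n) ⟩
    size 𝒜 n * size ℬ n                               ∎
    where
    open ≡-Reasoning
    to : ∀ {xy} → Initial (𝒜 ⊗ ℬ) n xy → (Initial 𝒜 n ⟨×⟩ Initial ℬ n) xy
    to (_ , k≤n , i , j , refl , a , b) =
      (i , ℕ.≤-trans (ℕ.m≤m⊔n i j) k≤n , a) , (j , ℕ.≤-trans (ℕ.m≤n⊔m i j) k≤n , b)
    from : ∀ {xy} → (Initial 𝒜 n ⟨×⟩ Initial ℬ n) xy → Initial (𝒜 ⊗ ℬ) n xy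
    from ((i , i≤n , a) , (j , j≤n , b)) = i ℕ.⊔ j , ℕ.⊔-lub i≤n j≤n , i , j , refl , a , b

  size-𝕀 : ∀ n → size 𝕀-arrangement n ≡ Φ n
  size-𝕀 n = ∑-cong n λ { (suc i) _ _ → length-map _ (totatives (suc i)) }

  -- The extra 1 comes from 0 and 1 sharing the first component; at n = 0 the size is still 0.
  size-ℕ₀ : ∀ n → n ≥ 1 → size ℕ₀-arrangement n ≡ n + 1
  size-ℕ₀ (suc zero)    _ = refl
  size-ℕ₀ (suc (suc n)) _ = trans (cong (_+ 1) (size-ℕ₀ (suc n) (s≤s z≤n))) (cong (_+ 1) (ℕ.+-comm (suc n) 1))

  size-ℚ⁺ : ∀ n → n ≥ 1 → size ℚ⁺-arrangement n ≡ (n + 1) * Φ n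
  size-ℚ⁺ n n≥1 = begin
    size ℚ⁺-arrangement n
      -- `transport` maps `mixed` over the elements of each component, which preserves their number.
      ≡⟨ ∑-cong n (λ i _ _ → length-map mixed (elements (finite (ℕ₀-arrangement ⊗ 𝕀-arrangement) i))) ⟩
    size (ℕ₀-arrangement ⊗ 𝕀-arrangement) n     ≡⟨ size-⊗ ℕ₀-arrangement 𝕀-arrangement n ⟩
    size ℕ₀-arrangement n * size 𝕀-arrangement n ≡⟨ cong₂ _*_ (size-ℕ₀ n n≥1) (size-𝕀 n) ⟩
    (n + 1) * Φ n                               ∎
    where open ≡-Reasoning

  -- Quadratic bounds for Φ from the sieve.

  open ℕ.≤-Reasoning

  -- The gap is the square of the difference k, obtained without subtraction by writing the larger
  -- number as the smaller plus k.
  2*m*n≤m²+n² : ∀ m n → 2 * (m * n) ≤ m * m + n * n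
  2*m*n≤m²+n² m n with ℕ.≤-total m n
  ... | inj₁ m≤n with ℕ.m≤n⇒∃[o]m+o≡n m≤n
  ... | k , refl = ℕ.≤-trans (ℕ.m≤m+n _ (k * k)) (ℕ.≤-reflexive (eq m k))
    where
    eq : ∀ m k → 2 * (m * (m + k)) + k * k ≡ m * m + (m + k) * (m + k)
    eq = solve-∀
  2*m*n≤m²+n² m n | inj₂ n≤m with ℕ.m≤n⇒∃[o]m+o≡n n≤m
  ... | k , refl = ℕ.≤-trans (ℕ.m≤m+n _ (k * k)) (ℕ.≤-reflexive (eq n k))
    where
    eq : ∀ n k → 2 * ((n + k) * n) + k * k ≡ (n + k) * (n + k) + n * n
    eq = solve-∀

  n≤[n/d]*d+[d-1] : ∀ n d-1 → n ≤ n / suc d-1 * suc d-1 + d-1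
  n≤[n/d]*d+[d-1] n d-1 = begin
    n                                              ≡⟨ m≡m%n+[m/n]*n n (suc d-1) ⟩
    n % suc d-1 + n / suc d-1 * suc d-1            ≤⟨ ℕ.+-monoˡ-≤ _ (ℕ.≤-pred (m%n<n n (suc d-1))) ⟩
    d-1 + n / suc d-1 * suc d-1                    ≡⟨ ℕ.+-comm d-1 _ ⟩
    n / suc d-1 * suc d-1 + d-1                    ∎

  -- Expresses T(q) through the product qd, which for q = n/d lies between n - (d - 1) and n.
  2d²*T : ∀ d q → 2 * (d * d) * T q ≡ q * d * (q * d + d)
  2d²*T d q = trans (eq₁ d (T q)) (trans (cong (d * d *_) (2*T q)) (eq₂ d q))
    where
    eq₁ : ∀ d t → 2 * (d * d) * t ≡ d * d * (2 * t)
    eq₁ = solve-∀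
    eq₂ : ∀ d q → d * d * (q * (q + 1)) ≡ q * d * (q * d + d)
    eq₂ = solve-∀

  T-quotient-≤ : ∀ n d .{{_ : NonZero d}} → 2 * (d * d) * T (n / d) ≤ n * (n + d)
  T-quotient-≤ n d = begin
    2 * (d * d) * T (n / d)            ≡⟨ 2d²*T d (n / d) ⟩
    n / d * d * (n / d * d + d)        ≤⟨ ℕ.*-mono-≤ (m/n*n≤m n d) (ℕ.+-monoˡ-≤ d (m/n*n≤m n d)) ⟩
    n * (n + d)                        ∎

  -- (n - e)(n + 1) ≤ 2d² T (n / d) for d = 1 + e, with the subtraction moved to the right.
  T-quotient-≥ : ∀ n e → n * (n + 1) ≤ 2 * (suc e * suc e) * T (n / suc e) + e * (n + 1)
  T-quotient-≥ n e = begin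
    n * (n + 1)                                       ≤⟨ ℕ.*-monoˡ-≤ (n + 1) (n≤[n/d]*d+[d-1] n e) ⟩
    (r + e) * (n + 1)                                 ≡⟨ ℕ.*-distribʳ-+ (n + 1) r e ⟩
    r * (n + 1) + e * (n + 1)                         ≤⟨ ℕ.+-monoˡ-≤ (e * (n + 1)) (ℕ.*-monoʳ-≤ r (begin
      n + 1                                             ≤⟨ ℕ.+-monoˡ-≤ 1 (n≤[n/d]*d+[d-1] n e) ⟩
      r + e + 1                                         ≡⟨ eq r e ⟩
      r + suc e                                         ∎)) ⟩
    r * (r + suc e) + e * (n + 1)                     ≡⟨ cong (_+ e * (n + 1)) (2d²*T (suc e) (n / suc e)) ⟨
    2 * (suc e * suc e) * T (n / suc e) + e * (n + 1) ∎
    where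
    r = n / suc e * suc e
    eq : ∀ r e → r + e + 1 ≡ r + suc e
    eq = solve-∀


  -- Both estimates come from 72 (T(n) + T(n/6) - T(n/2) - T(n/3)) = 24n² + O(n),
  -- where 24 = 36 + 1 - 9 - 4.
  72*Φ-sieved : ∀ n →
    72 * Φ n + 72 * A n + 9 * (2 * (2 * 2) * T (n / 2)) + 4 * (2 * (3 * 3) * T (n / 3))
    ≡ 36 * (n * (n + 1)) + 2 * (6 * 6) * T (n / 6)
  72*Φ-sieved n = begin-equality
    72 * Φ n + 72 * A n + 9 * (2 * (2 * 2) * T (n / 2)) + 4 * (2 * (3 * 3) * T (n / 3))
      ≡⟨ eq₁ (Φ n) (A n) (T (n / 2)) (T (n / 3)) ⟩
    72 * (Φ n + A n + (T (n / 2) + T (n / 3)))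
      ≡⟨ cong (72 *_) (Φ-sieved n) ⟨
    72 * (T n + T (n / 6))
      ≡⟨ eq₂ (T n) (T (n / 6)) ⟩
    36 * (2 * T n) + 2 * (6 * 6) * T (n / 6)
      ≡⟨ cong (λ t → 36 * t + 2 * (6 * 6) * T (n / 6)) (2*T n) ⟩
    36 * (n * (n + 1)) + 2 * (6 * 6) * T (n / 6) ∎
    where
    eq₁ : ∀ p a t₂ t₃ → 72 * p + 72 * a + 9 * (2 * (2 * 2) * t₂) + 4 * (2 * (3 * 3) * t₃)
                      ≡ 72 * (p + a + (t₂ + t₃))
    eq₁ = solve-∀
    eq₂ : ∀ t₁ t₆ → 72 * (t₁ + t₆) ≡ 36 * (2 * t₁) + 2 * (6 * 6) * t₆
    eq₂ = solve-∀

  -- `72*Φ-sieved` with T(n/2) and T(n/3) bounded from above and T(n/6) from below. The linear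
  -- terms, 37n against 35n, fall on the favourable side, so the error is a constant.
  n²≤3Φ+3A+3 : ∀ n → n * n ≤ 3 * Φ n + 3 * A n + 3
  n²≤3Φ+3A+3 n = ℕ.*-cancelˡ-≤ 24 (ℕ.+-cancelʳ-≤ (13 * (n * n) + 35 * n + 5) _ _ (begin
    24 * (n * n) + (13 * (n * n) + 35 * n + 5)
      -- The surplus of 37n + 72 over 35n + 5, where 72 = 24 · 3.
      ≤⟨ ℕ.m≤m+n _ (2 * n + 67) ⟩
    24 * (n * n) + (13 * (n * n) + 35 * n + 5) + (2 * n + 67)
      ≡⟨ eq₁ n ⟩
    36 * (n * (n + 1)) + n * (n + 1) + 72
      ≤⟨ ℕ.+-monoˡ-≤ 72 (ℕ.+-monoʳ-≤ (36 * (n * (n + 1))) (T-quotient-≥ n 5)) ⟩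
    36 * (n * (n + 1)) + (2 * (6 * 6) * T (n / 6) + 5 * (n + 1)) + 72
      ≡⟨ cong (_+ 72) (ℕ.+-assoc (36 * (n * (n + 1))) (2 * (6 * 6) * T (n / 6)) (5 * (n + 1))) ⟨
    36 * (n * (n + 1)) + 2 * (6 * 6) * T (n / 6) + 5 * (n + 1) + 72
      ≡⟨ cong (λ s → s + 5 * (n + 1) + 72) (72*Φ-sieved n) ⟨
    72 * Φ n + 72 * A n + 9 * (2 * (2 * 2) * T (n / 2)) + 4 * (2 * (3 * 3) * T (n / 3)) + 5 * (n + 1) + 72
      ≤⟨ ℕ.+-monoˡ-≤ 72 (ℕ.+-monoˡ-≤ (5 * (n + 1)) (ℕ.+-mono-≤
           (ℕ.+-monoʳ-≤ (72 * Φ n + 72 * A n) (ℕ.*-monoʳ-≤ 9 (T-quotient-≤ n 2)))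
           (ℕ.*-monoʳ-≤ 4 (T-quotient-≤ n 3)))) ⟩
    72 * Φ n + 72 * A n + 9 * (n * (n + 2)) + 4 * (n * (n + 3)) + 5 * (n + 1) + 72
      ≡⟨ eq₂ n (Φ n) (A n) ⟩
    24 * (3 * Φ n + 3 * A n + 3) + (13 * (n * n) + 35 * n + 5) ∎))
    where
    eq₁ : ∀ n → 24 * (n * n) + (13 * (n * n) + 35 * n + 5) + (2 * n + 67)
              ≡ 36 * (n * (n + 1)) + n * (n + 1) + 72
    eq₁ = solve-∀
    eq₂ : ∀ n p a →
      72 * p + 72 * a + 9 * (n * (n + 2)) + 4 * (n * (n + 3)) + 5 * (n + 1) + 72
      ≡ 24 * (3 * p + 3 * a + 3) + (13 * (n * n) + 35 * n + 5)
    eq₂ = solve-∀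

  -- The same identity with A dropped and the three bounds on T reversed.
  3Φ≤n²+3n : ∀ n → 3 * Φ n ≤ n * n + 3 * n
  3Φ≤n²+3n zero      = z≤n
  3Φ≤n²+3n n@(suc m) = ℕ.*-cancelˡ-≤ 24 (ℕ.+-cancelʳ-≤ (13 * (n * (n + 1))) _ _ (begin
    24 * (3 * Φ n) + 13 * (n * (n + 1))
      ≡⟨ eq₁ (Φ n) (n * (n + 1)) ⟩
    72 * Φ n + 9 * (n * (n + 1)) + 4 * (n * (n + 1))
      ≤⟨ ℕ.+-mono-≤ (ℕ.+-mono-≤ (ℕ.m≤m+n (72 * Φ n) (72 * A n)) (ℕ.*-monoʳ-≤ 9 (T-quotient-≥ n 1)))
           (ℕ.*-monoʳ-≤ 4 (T-quotient-≥ n 2)) ⟩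
    72 * Φ n + 72 * A n + 9 * (2 * (2 * 2) * T (n / 2) + 1 * (n + 1))
      + 4 * (2 * (3 * 3) * T (n / 3) + 2 * (n + 1))
      ≡⟨ eq₂ (72 * Φ n + 72 * A n) (2 * (2 * 2) * T (n / 2)) (2 * (3 * 3) * T (n / 3)) (n + 1) ⟩
    72 * Φ n + 72 * A n + 9 * (2 * (2 * 2) * T (n / 2)) + 4 * (2 * (3 * 3) * T (n / 3)) + 17 * (n + 1)
      ≡⟨ cong (_+ 17 * (n + 1)) (72*Φ-sieved n) ⟩
    36 * (n * (n + 1)) + 2 * (6 * 6) * T (n / 6) + 17 * (n + 1)
      ≤⟨ ℕ.+-monoˡ-≤ (17 * (n + 1)) (ℕ.+-monoʳ-≤ (36 * (n * (n + 1))) (T-quotient-≤ n 6)) ⟩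
    36 * (n * (n + 1)) + n * (n + 6) + 17 * (n + 1)
      -- The surplus is 26n - 17 with n = m + 1; it is negative at n = 0, hence the separate case.
      ≤⟨ ℕ.m≤m+n _ (26 * m + 9) ⟩
    36 * (n * (n + 1)) + n * (n + 6) + 17 * (n + 1) + (26 * m + 9)
      ≡⟨ eq₃ m ⟩
    24 * (n * n + 3 * n) + 13 * (n * (n + 1)) ∎))
    where
    eq₁ : ∀ p s → 24 * (3 * p) + 13 * s ≡ 72 * p + 9 * s + 4 * s
    eq₁ = solve-∀
    eq₂ : ∀ p t₂ t₃ s → p + 9 * (t₂ + 1 * s) + 4 * (t₃ + 2 * s) ≡ p + 9 * t₂ + 4 * t₃ + 17 * s
    eq₂ = solve-∀
    eq₃ : ∀ m → let n = suc m in
      36 * (n * (n + 1)) + n * (n + 6) + 17 * (n + 1) + (26 * m + 9)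
      ≡ 24 * (n * n + 3 * n) + 13 * (n * (n + 1))
    eq₃ = solve-∀

  -- Absorbing the linear term by 2·60·n ≤ n² + 60² avoids a harmonic sum when summing over n/m.
  120Φ≤41n²+3600 : ∀ n → 120 * Φ n ≤ 41 * (n * n) + 3600
  120Φ≤41n²+3600 n = begin
    120 * Φ n                            ≡⟨ ℕ.*-assoc 40 3 (Φ n) ⟩
    40 * (3 * Φ n)                       ≤⟨ ℕ.*-monoʳ-≤ 40 (3Φ≤n²+3n n) ⟩
    40 * (n * n + 3 * n)                 ≡⟨ eq₁ n ⟩
    40 * (n * n) + 2 * (n * 60)          ≤⟨ ℕ.+-monoʳ-≤ (40 * (n * n)) (2*m*n≤m²+n² n 60) ⟩
    40 * (n * n) + (n * n + 3600)        ≡⟨ eq₂ (n * n) 3600 ⟩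
    41 * (n * n) + 3600                  ∎
    where
    eq₁ : ∀ n → 40 * (n * n + 3 * n) ≡ 40 * (n * n) + 2 * (n * 60)
    eq₁ = solve-∀
    eq₂ : ∀ s c → 40 * s + (s + c) ≡ 41 * s + c
    eq₂ = solve-∀

  -- The sum of squared quotients over 6k ± 1.

  infix 9 _²
  _² : ℕ → ℕ
  n ² = n * n

  squares : ℕ → ℕ → ℕ
  squares n k = (n ÷ pred (k * 6)) ² + (n ÷ suc (k * 6)) ²

  -- The constant 3600 is paid twice for each of n values of k, so the error is linear and loses to
  -- n² in the end.
  120A≤41∑squares+7200n : ∀ n → 120 * A n ≤ 41 * ∑₁ n (squares n) + n * 7200
  120A≤41∑squares+7200n n = begin
    120 * A n                                         ≡⟨ ∑-* n 120 _ ⟨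
    ∑₁ n (λ k → 120 * (Φ (u k) + Φ (v k)))            ≤⟨ ∑-mono n (λ k _ → step (u k) (v k)) ⟩
    ∑₁ n (λ k → 41 * squares n k + 7200)              ≡⟨ ∑-+ n (λ k → 41 * squares n k) (λ _ → 7200) ⟩
    ∑₁ n (λ k → 41 * squares n k) + ∑₁ n (λ _ → 7200) ≡⟨ cong₂ _+_ (∑-* n 41 (squares n)) (∑-const n 7200) ⟩
    41 * ∑₁ n (squares n) + n * 7200                  ∎
    where
    u v : ℕ → ℕ
    u k = n ÷ pred (k * 6)
    v k = n ÷ suc (k * 6)
    eq : ∀ a b c → 41 * a + c + (41 * b + c) ≡ 41 * (a + b) + 2 * c
    eq = solve-∀
    step : ∀ x y → 120 * (Φ x + Φ y) ≤ 41 * (x ² + y ²) + 7200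
    step x y = begin
      120 * (Φ x + Φ y)                        ≡⟨ ℕ.*-distribˡ-+ 120 (Φ x) (Φ y) ⟩
      120 * Φ x + 120 * Φ y                    ≤⟨ ℕ.+-mono-≤ (120Φ≤41n²+3600 x) (120Φ≤41n²+3600 y) ⟩
      41 * x ² + 3600 + (41 * y ² + 3600)      ≡⟨ eq (x ²) (y ²) 3600 ⟩
      41 * (x ² + y ²) + 7200                  ∎

  -- 1/(d+2)² + 1/(d+4)² ≤ 2/(d(d+6)): with c = d + 3 it reads (c² - 9)(c² + 1) ≤ (c² - 1)².
  pair-bound : ∀ n d {x y} → x * (2 + d) ≤ n → y * (4 + d) ≤ n → d * (6 + d) * (x ² + y ²) ≤ 2 * n ²
  pair-bound n d {x} {y} xu≤n yv≤n = ℕ.*-cancelʳ-≤ _ _ ((2 + d) ² * (4 + d) ²) (begin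
    d * (6 + d) * (x ² + y ²) * ((2 + d) ² * (4 + d) ²)
      ≡⟨ eq₁ (d * (6 + d)) x y (2 + d) (4 + d) ⟩
    d * (6 + d) * ((x * (2 + d)) ² * (4 + d) ² + (y * (4 + d)) ² * (2 + d) ²)
      ≤⟨ ℕ.*-monoʳ-≤ (d * (6 + d)) (ℕ.+-mono-≤
           (ℕ.*-monoˡ-≤ ((4 + d) ²) (ℕ.*-mono-≤ xu≤n xu≤n))
           (ℕ.*-monoˡ-≤ ((2 + d) ²) (ℕ.*-mono-≤ yv≤n yv≤n))) ⟩
    d * (6 + d) * (n ² * (4 + d) ² + n ² * (2 + d) ²)
      ≤⟨ ℕ.m≤m+n _ (n ² * (12 * (3 + d) ² + 20)) ⟩
    d * (6 + d) * (n ² * (4 + d) ² + n ² * (2 + d) ²) + n ² * (12 * (3 + d) ² + 20)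
      ≡⟨ eq₂ (n ²) d ⟩
    2 * n ² * ((2 + d) ² * (4 + d) ²) ∎)
    where
    eq₁ : ∀ w x y u v → w * (x * x + y * y) * (u * u * (v * v))
                      ≡ w * (x * u * (x * u) * (v * v) + y * v * (y * v) * (u * u))
    eq₁ = solve-∀
    eq₂ : ∀ s d → d * (6 + d) * (s * ((4 + d) * (4 + d)) + s * ((2 + d) * (2 + d)))
                  + s * (12 * ((3 + d) * (3 + d)) + 20)
                ≡ 2 * s * ((2 + d) * (2 + d) * ((4 + d) * (4 + d)))
    eq₂ = solve-∀

  -- pair-bound telescopes, since 2/(d(d+6)) = 1/(3d) - 1/(3(d+6)) and d = 9 + 6j advances by 6.
  tail-telescoped : ∀ n j →
    9 * (9 + j * 6) * ∑₁ j (λ i → squares n (suc i)) ≤ n ² * (2 * j)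
  tail-telescoped n zero    = z≤n
  tail-telescoped n (suc j) = ℕ.*-cancelʳ-≤ _ _ d (begin
    9 * (6 + d) * (t + a) * d
      ≡⟨ eq₁ d t a ⟩
    (6 + d) * (9 * d * t) + 9 * (d * (6 + d) * a)
      ≤⟨ ℕ.+-mono-≤ (ℕ.*-monoʳ-≤ (6 + d) (tail-telescoped n j))
           (ℕ.*-monoʳ-≤ 9 (pair-bound n d {n / (2 + d)} {n / (4 + d)} (m/n*n≤m n (2 + d)) (m/n*n≤m n (4 + d)))) ⟩
    (6 + d) * (n ² * (2 * j)) + 9 * (2 * n ²)
      ≡⟨ eq₂ (n ²) j ⟩
    n ² * (2 * suc j) * d ∎)
    where
    d = 9 + j * 6
    t = ∑₁ j (λ i → squares n (suc i))
    -- For k = j + 2 the numbers 6k - 1 and 6k + 1 are 2 + d and 4 + d, as `pair-bound` expects.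
    a = squares n (suc (suc j))
    eq₁ : ∀ d t a → 9 * (6 + d) * (t + a) * d ≡ (6 + d) * (9 * d * t) + 9 * (d * (6 + d) * a)
    eq₁ = solve-∀
    eq₂ : ∀ s j → (6 + (9 + j * 6)) * (s * (2 * j)) + 9 * (2 * s) ≡ s * (2 * suc j) * (9 + j * 6)
    eq₂ = solve-∀

  -- The telescoped value 2j/(9(9 + 6j)) stays below its limit 1/27 because 6j ≤ 9 + 6j; the gap is
  -- the 9n² added below.
  tail-bound : ∀ n j → 27 * ∑₁ j (λ i → squares n (suc i)) ≤ n ²
  tail-bound n j = ℕ.*-cancelʳ-≤ _ _ d (begin
    27 * t * d            ≡⟨ eq₁ t d ⟩
    3 * (9 * d * t)       ≤⟨ ℕ.*-monoʳ-≤ 3 (tail-telescoped n j) ⟩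
    3 * (n ² * (2 * j))   ≤⟨ ℕ.m≤m+n _ (9 * n ²) ⟩
    3 * (n ² * (2 * j)) + 9 * n ² ≡⟨ eq₂ (n ²) j ⟩
    n ² * d               ∎)
    where
    d = 9 + j * 6
    t = ∑₁ j (λ i → squares n (suc i))
    eq₁ : ∀ t d → 27 * t * d ≡ 3 * (9 * d * t)
    eq₁ = solve-∀
    eq₂ : ∀ s j → 3 * (s * (2 * j)) + 9 * s ≡ s * (9 + j * 6)
    eq₂ = solve-∀

  quotient²-≤ : ∀ n d .{{_ : NonZero d}} → d ² * (n / d) ² ≤ n ²
  quotient²-≤ n d = ℕ.≤-trans (ℕ.≤-reflexive (eq d (n / d))) (ℕ.*-mono-≤ (m/n*n≤m n d) (m/n*n≤m n d))
    where
    eq : ∀ d q → d * d * (q * q) ≡ q * d * (q * d)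
    eq = solve-∀

  -- The last hypothesis is 1/c + 1/a + 1/b ≤ w/(kc), cleared of denominators.
  weighted-sum-≤ : ∀ a b c k w .{{_ : NonZero (a * b)}} {x y t s} →
    c * x ≤ s → a * y ≤ s → b * t ≤ s →
    k * (a * b) + k * c * b + k * c * a ≤ a * b * w →
    k * c * (x + y + t) ≤ w * s
  weighted-sum-≤ a b c k w {x} {y} {t} {s} x≤ y≤ t≤ w≥ = ℕ.*-cancelˡ-≤ (a * b) (begin
    a * b * (k * c * (x + y + t))
      ≡⟨ eq₁ a b c k x y t ⟩
    k * (a * b) * (c * x) + k * c * b * (a * y) + k * c * a * (b * t)
      ≤⟨ ℕ.+-mono-≤ (ℕ.+-mono-≤ (ℕ.*-monoʳ-≤ (k * (a * b)) x≤) (ℕ.*-monoʳ-≤ (k * c * b) y≤))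
                    (ℕ.*-monoʳ-≤ (k * c * a) t≤) ⟩
    k * (a * b) * s + k * c * b * s + k * c * a * s
      ≡⟨ eq₂ (k * (a * b)) (k * c * b) (k * c * a) s ⟩
    (k * (a * b) + k * c * b + k * c * a) * s
      ≤⟨ ℕ.*-monoˡ-≤ s w≥ ⟩
    a * b * w * s
      ≡⟨ ℕ.*-assoc (a * b) w s ⟩
    a * b * (w * s) ∎)
    where
    eq₁ : ∀ a b c k x y t → a * b * (k * c * (x + y + t))
          ≡ k * (a * b) * (c * x) + k * c * b * (a * y) + k * c * a * (b * t)
    eq₁ = solve-∀
    eq₂ : ∀ p q r s → p * s + q * s + r * s ≡ (p + q + r) * s
    eq₂ = solve-∀

  -- 1/25 + 1/49 + 1/27 < 39/400
  400∑squares≤39n² : ∀ n N → 400 * ∑₁ N (squares n) ≤ 39 * n ²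
  400∑squares≤39n² n zero    = z≤n
  400∑squares≤39n² n (suc j) = begin
    400 * ∑₁ (suc j) (squares n)
      -- The pair 5, 7 is kept exact: telescoping from it on would only give 1/9, which is too
      -- large.
      ≡⟨ cong (400 *_) (∑-split 1 j (squares n)) ⟩
    400 * ((n / 5) ² + (n / 7) ² + ∑₁ j (λ i → squares n (suc i)))
      ≤⟨ weighted-sum-≤ 49 27 25 16 39 {(n / 5) ²} {(n / 7) ²} {∑₁ j λ i → squares n (suc i)} {n ²}
           (quotient²-≤ n 5) (quotient²-≤ n 7) (tail-bound n j) le ⟩
    39 * n ² ∎
    where
    -- 16·49·27 + 400·27 + 400·49 against 49·27·39.
    le : 51568 ≤ 51597
    le = ℕ.m≤m+n 51568 29

  -- Explicit bounds for Φ and for the sizes.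

  c*n+e<n² : ∀ {n} c {e} → c < n → e < n → c * n + e < n ²
  c*n+e<n² {n} c {e} c<n e<n = begin-strict
    c * n + e   <⟨ ℕ.+-monoʳ-< (c * n) e<n ⟩
    c * n + n   ≡⟨ ℕ.+-comm (c * n) n ⟩
    suc c * n   ≤⟨ ℕ.*-monoˡ-≤ n c<n ⟩
    n ²         ∎

  -- A ≤ (41·39/48000) n² + O(n), and 1/3 - 41·39/48000 = 14401/48000 just exceeds 3/10.
  combine : ∀ k w {n p a b} .{{_ : NonZero (12 * k)}} →
    n ² ≤ 3 * p + 3 * a + 3 → 120 * a ≤ 41 * b + n * w → k * b ≤ 39 * n ² →
    1600 ≤ 4 * k → k * w < n → 120 * k < n → 3 * n ² < 10 * p
  combine k w {n} {p} {a} {b} s≤ a≤ b≤ 1600≤4k kw<n 120k<n =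
    ℕ.*-cancelˡ-< (12 * k) _ _ (ℕ.+-cancelʳ-< (4 * k * n ²) _ _ (begin-strict
      12 * k * (3 * n ²) + 4 * k * n ²
        ≡⟨ eq₁ k (n ²) ⟩
      40 * k * n ²
        ≤⟨ ℕ.*-monoʳ-≤ (40 * k) s≤ ⟩
      40 * k * (3 * p + 3 * a + 3)
        ≡⟨ eq₂ k p a ⟩
      12 * k * (10 * p) + (k * (120 * a) + 120 * k)
        ≤⟨ ℕ.+-monoʳ-≤ (12 * k * (10 * p)) (ℕ.+-monoˡ-≤ (120 * k) (ℕ.*-monoʳ-≤ k a≤)) ⟩
      12 * k * (10 * p) + (k * (41 * b + n * w) + 120 * k)
        ≡⟨ cong (12 * k * (10 * p) +_) (eq₃ k b n w) ⟩
      12 * k * (10 * p) + (41 * (k * b) + (k * w * n + 120 * k))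
        <⟨ ℕ.+-monoʳ-< (12 * k * (10 * p)) (ℕ.+-mono-≤-< (ℕ.*-monoʳ-≤ 41 b≤) (c*n+e<n² (k * w) kw<n 120k<n)) ⟩
      12 * k * (10 * p) + (41 * (39 * n ²) + n ²)
        -- 41 · 39 = 1599 is one short of 1600; the spare n² is what absorbed the linear error.
        ≡⟨ cong (12 * k * (10 * p) +_) (eq₄ (n ²)) ⟩
      12 * k * (10 * p) + 1600 * n ²
        ≤⟨ ℕ.+-monoʳ-≤ (12 * k * (10 * p)) (ℕ.*-monoˡ-≤ (n ²) 1600≤4k) ⟩
      12 * k * (10 * p) + 4 * k * n ² ∎))
    where
    eq₁ : ∀ k s → 12 * k * (3 * s) + 4 * k * s ≡ 40 * k * s
    eq₁ = solve-∀
    eq₂ : ∀ k p a → 40 * k * (3 * p + 3 * a + 3) ≡ 12 * k * (10 * p) + (k * (120 * a) + 120 * k)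
    eq₂ = solve-∀
    eq₃ : ∀ k b n w → k * (41 * b + n * w) + 120 * k ≡ 41 * (k * b) + (k * w * n + 120 * k)
    eq₃ = solve-∀
    eq₄ : ∀ s → 41 * (39 * s) + s ≡ 1600 * s
    eq₄ = solve-∀

  -- After scaling by 400 the error is 400·7200·n + 120·400, which n² exceeds once n > 400·7200.
  3n²<10Φ : ∀ n → 400 * 7200 < n → 3 * n ² < 10 * Φ n
  3n²<10Φ n large = combine 400 7200 {n} {Φ n} {A n} {∑₁ n (squares n)}
    (n²≤3Φ+3A+3 n) (120A≤41∑squares+7200n n) (400∑squares≤39n² n n)
    ℕ.≤-refl large (ℕ.≤-<-trans (ℕ.≤ᵇ⇒≤ (120 * 400) (400 * 7200) _) large)

  -- Tripled, `3Φ≤n²+3n` leaves one of the 3n² free, and this absorbs 9n once n > 9.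
  2Φ+n<n² : ∀ n → 9 < n → 2 * Φ n + n < n ²
  2Φ+n<n² n 9<n = ℕ.*-cancelˡ-< 3 _ _ (begin-strict
    3 * (2 * Φ n + n)                ≡⟨ eq₁ (Φ n) n ⟩
    2 * (3 * Φ n) + 3 * n            ≤⟨ ℕ.+-monoˡ-≤ (3 * n) (ℕ.*-monoʳ-≤ 2 (3Φ≤n²+3n n)) ⟩
    2 * (n ² + 3 * n) + 3 * n        ≡⟨ eq₂ (n ²) n ⟩
    2 * n ² + (9 * n + 0)            <⟨ ℕ.+-monoʳ-< (2 * n ²) (c*n+e<n² 9 9<n (ℕ.≤-<-trans z≤n 9<n)) ⟩
    2 * n ² + n ²                    ≡⟨ ℕ.+-comm (2 * n ²) (n ²) ⟩
    3 * n ²                          ∎)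
    where
    eq₁ : ∀ p n → 3 * (2 * p + n) ≡ 2 * (3 * p) + 3 * n
    eq₁ = solve-∀
    eq₂ : ∀ s n → 2 * (s + 3 * n) + 3 * n ≡ 2 * s + (9 * n + 0)
    eq₂ = solve-∀

  -- Multiplying n² by the n + 1 elements of the integer part produces exactly n³ + n².
  10*size>3n³+3n² : ∀ n → 400 * 7200 < n → 3 * (n ℕ.^ 3 + n ℕ.^ 2) < 10 * size ℚ⁺-arrangement n
  10*size>3n³+3n² n large rewrite size-ℚ⁺ n (ℕ.≤-trans (s≤s z≤n) large) =
    subst₂ _<_ (eq₁ n) (eq₂ n (Φ n)) (ℕ.*-monoʳ-< (suc n) (3n²<10Φ n large))
    where
    eq₁ : ∀ n → suc n * (3 * (n * n)) ≡ 3 * (n * (n * (n * 1)) + n * (n * 1))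
    eq₁ = solve-∀
    eq₂ : ∀ n p → suc n * (10 * p) ≡ 10 * ((n + 1) * p)
    eq₂ = solve-∀

  -- Multiplying `2Φ+n<n²` by n + 1 puts an extra n² + n on the left and n² on the right; the
  -- surviving n becomes the subtracted α of the upper bound.
  2*size+n<n³ : ∀ n → 9 < n → 2 * size ℚ⁺-arrangement n + n < n ℕ.^ 3
  2*size+n<n³ n 9<n rewrite size-ℚ⁺ n (ℕ.≤-trans (s≤s z≤n) 9<n) =
    ℕ.+-cancelʳ-< (n ²) _ _
      (subst₂ _<_ (eq₁ n (Φ n)) (eq₂ n) (ℕ.*-monoʳ-< (suc n) (2Φ+n<n² n 9<n)))
    where
    eq₁ : ∀ n p → suc n * (2 * p + n) ≡ 2 * ((n + 1) * p) + n + n * n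
    eq₁ = solve-∀
    eq₂ : ∀ n → suc n * (n * n) ≡ n * (n * (n * 1)) + n * n
    eq₂ = solve-∀

-- Transfer to rational sequences.

open Counting
open Defs using (_+_; _-_; _*_; _^_)
open import Data.Integer.Base using (+_)
open import Data.Rational.Base using (_/_)

fromℕ-+ : ∀ m n → fromℕ (m ℕ.+ n) ≡ fromℕ m ℚ.+ fromℕ n
fromℕ-+ zero    n = sym (ℚ.+-identityˡ (fromℕ n))
fromℕ-+ (suc m) n = begin
  fromℕ (suc (m ℕ.+ n))         ≡⟨ fromℕ-suc (m ℕ.+ n) ⟩
  fromℕ (m ℕ.+ n) ℚ.+ 1ℚ        ≡⟨ cong (ℚ._+ 1ℚ) (trans (fromℕ-+ m n) (ℚ.+-comm (fromℕ m) (fromℕ n))) ⟩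
  fromℕ n ℚ.+ fromℕ m ℚ.+ 1ℚ    ≡⟨ ℚ.+-assoc (fromℕ n) (fromℕ m) 1ℚ ⟩
  fromℕ n ℚ.+ (fromℕ m ℚ.+ 1ℚ)  ≡⟨ cong (fromℕ n ℚ.+_) (fromℕ-suc m) ⟨
  fromℕ n ℚ.+ fromℕ (suc m)     ≡⟨ ℚ.+-comm (fromℕ n) (fromℕ (suc m)) ⟩
  fromℕ (suc m) ℚ.+ fromℕ n     ∎
  where open ≡-Reasoning

fromℕ-* : ∀ m n → fromℕ (m ℕ.* n) ≡ fromℕ m ℚ.* fromℕ n
fromℕ-* zero    n = sym (ℚ.*-zeroˡ (fromℕ n))
fromℕ-* (suc m) n = begin
  fromℕ (n ℕ.+ m ℕ.* n)                   ≡⟨ fromℕ-+ n (m ℕ.* n) ⟩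
  fromℕ n ℚ.+ fromℕ (m ℕ.* n)             ≡⟨ ℚ.+-comm (fromℕ n) (fromℕ (m ℕ.* n)) ⟩
  fromℕ (m ℕ.* n) ℚ.+ fromℕ n             ≡⟨ cong₂ ℚ._+_ (fromℕ-* m n) (sym (ℚ.*-identityˡ (fromℕ n))) ⟩
  fromℕ m ℚ.* fromℕ n ℚ.+ 1ℚ ℚ.* fromℕ n  ≡⟨ ℚ.*-distribʳ-+ (fromℕ n) (fromℕ m) 1ℚ ⟨
  (fromℕ m ℚ.+ 1ℚ) ℚ.* fromℕ n            ≡⟨ cong (ℚ._* fromℕ n) (fromℕ-suc m) ⟨
  fromℕ (suc m) ℚ.* fromℕ n               ∎
  where open ≡-Reasoning

α^ : ∀ n k → (α ^ k) n ≡ fromℕ (n ℕ.^ k)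
α^ n zero    = refl
α^ n (suc k) = trans (cong (fromℕ n ℚ.*_) (α^ n k)) (sym (fromℕ-* n (n ℕ.^ k)))

fromℕ-mono-< : ∀ {m n} → m < n → fromℕ m ℚ.< fromℕ n
fromℕ-mono-< {m} {n} m<n = begin-strict
  fromℕ m         ≡⟨ ℚ.+-identityʳ (fromℕ m) ⟨
  fromℕ m ℚ.+ 0ℚ  <⟨ ℚ.+-monoʳ-< (fromℕ m) (ℚ.positive⁻¹ 1ℚ) ⟩
  fromℕ m ℚ.+ 1ℚ  ≡⟨ fromℕ-suc m ⟨
  fromℕ (suc m)   ≤⟨ fromℕ-mono-≤ m<n ⟩
  fromℕ n         ∎
  where open ℚ.≤-Reasoning

σ-factorisation : σ ℚ⁺-arrangement ≋ (α + const 1ℚ) * σ 𝕀-arrangement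
σ-factorisation n n≥1 = begin
  fromℕ (size ℚ⁺-arrangement n)  ≡⟨ cong fromℕ (size-ℚ⁺ n n≥1) ⟩
  fromℕ ((n ℕ.+ 1) ℕ.* Φ n)      ≡⟨ fromℕ-* (n ℕ.+ 1) (Φ n) ⟩
  fromℕ (n ℕ.+ 1) ℚ.* fromℕ (Φ n)
    ≡⟨ cong₂ ℚ._*_ (fromℕ-+ n 1) (cong fromℕ (sym (size-𝕀 n))) ⟩
  (fromℕ n ℚ.+ 1ℚ) ℚ.* fromℕ (size 𝕀-arrangement n)  ∎
  where open ≡-Reasoning

σ-≈ℱ-α³ : σ ℚ⁺-arrangement ≈ℱ α ^ 3
-- 4 works because 3n³ ≤ 10σ ≤ 12σ, and 1 because 2σ + n < n³.
σ-≈ℱ-α³ = (4 , s≤s z≤n , suc (400 ℕ.* 7200) , lower) , (1 , s≤s z≤n , 10 , upper)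
  where
  lower : ∀ n → n ≥ suc (400 ℕ.* 7200) → fromℕ 4 ℚ.* σ ℚ⁺-arrangement n ℚ.≥ (α ^ 3) n
  lower n large = subst₂ ℚ._≤_ (sym (α^ n 3)) (fromℕ-* 4 (size ℚ⁺-arrangement n))
    (fromℕ-mono-≤ (ℕ.*-cancelˡ-≤ {n ℕ.^ 3} {4 ℕ.* s} 3 (begin
      3 ℕ.* n ℕ.^ 3                ≤⟨ ℕ.*-monoʳ-≤ 3 (ℕ.m≤m+n (n ℕ.^ 3) (n ℕ.^ 2)) ⟩
      3 ℕ.* (n ℕ.^ 3 ℕ.+ n ℕ.^ 2)  ≤⟨ ℕ.<⇒≤ (10*size>3n³+3n² n large) ⟩
      10 ℕ.* s                     ≤⟨ ℕ.*-monoˡ-≤ s (ℕ.m≤m+n 10 2) ⟩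
      12 ℕ.* s                     ≡⟨ ℕ.*-assoc 3 4 s ⟩
      3 ℕ.* (4 ℕ.* s)              ∎)))
    where
    open ℕ.≤-Reasoning
    s = size ℚ⁺-arrangement n

  upper : ∀ n → n ≥ 10 → fromℕ 1 ℚ.* (α ^ 3) n ℚ.≥ σ ℚ⁺-arrangement n
  upper n n≥10 = subst (fromℕ s ℚ.≤_) (sym (trans (ℚ.*-identityˡ ((α ^ 3) n)) (α^ n 3)))
    (fromℕ-mono-≤ (begin
      s              ≤⟨ ℕ.m≤m+n s (s ℕ.+ 0) ⟩
      2 ℕ.* s        ≤⟨ ℕ.m≤m+n (2 ℕ.* s) n ⟩
      2 ℕ.* s ℕ.+ n  ≤⟨ ℕ.<⇒≤ (2*size+n<n³ n n≥10) ⟩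
      n ℕ.^ 3        ∎))
    where
    open ℕ.≤-Reasoning
    s = size ℚ⁺-arrangement n

σ-lower : const (+ 3 / 10) * (α ^ 3 + α ^ 2) <ℱ σ ℚ⁺-arrangement
σ-lower = suc (400 ℕ.* 7200) , λ n large →
  ℚ.*-cancelˡ-<-nonNeg (fromℕ 10) (subst₂ ℚ._<_ (scaled n) (fromℕ-* 10 (size ℚ⁺-arrangement n))
    (fromℕ-mono-< (10*size>3n³+3n² n large)))
  where
  scaled : ∀ n → fromℕ (3 ℕ.* (n ℕ.^ 3 ℕ.+ n ℕ.^ 2)) ≡ fromℕ 10 ℚ.* (+ 3 / 10 ℚ.* ((α ^ 3) n ℚ.+ (α ^ 2) n))
  scaled n = begin
    fromℕ (3 ℕ.* (n ℕ.^ 3 ℕ.+ n ℕ.^ 2))  ≡⟨ fromℕ-* 3 (n ℕ.^ 3 ℕ.+ n ℕ.^ 2) ⟩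
    fromℕ 3 ℚ.* fromℕ (n ℕ.^ 3 ℕ.+ n ℕ.^ 2)
      ≡⟨ cong (fromℕ 3 ℚ.*_) (fromℕ-+ (n ℕ.^ 3) (n ℕ.^ 2)) ⟩
    fromℕ 3 ℚ.* (fromℕ (n ℕ.^ 3) ℚ.+ fromℕ (n ℕ.^ 2))  ≡⟨ cong₂ (λ a b → fromℕ 3 ℚ.* (a ℚ.+ b)) (α^ n 3) (α^ n 2) ⟨
    fromℕ 3 ℚ.* ((α ^ 3) n ℚ.+ (α ^ 2) n)
      -- 10 · 3/10 evaluates to 3, so associativity suffices.
      ≡⟨ ℚ.*-assoc (fromℕ 10) (+ 3 / 10) ((α ^ 3) n ℚ.+ (α ^ 2) n) ⟩
    fromℕ 10 ℚ.* (+ 3 / 10 ℚ.* ((α ^ 3) n ℚ.+ (α ^ 2) n))  ∎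
    where open ≡-Reasoning

σ-upper : σ ℚ⁺-arrangement <ℱ const ½ * (α ^ 3 - α)
σ-upper = 10 , λ n n≥10 →
  ℚ.*-cancelˡ-<-nonNeg (fromℕ 2) (subst₂ ℚ._<_ (left n) (right n)
    -- The inequality stays additive in ℕ; n is subtracted only in ℚ, where subtraction does not
    -- truncate.
    (ℚ.+-monoˡ-< (ℚ.- fromℕ n) (fromℕ-mono-< (2*size+n<n³ n n≥10))))
  where
  open ≡-Reasoning
  left : ∀ n → let s = size ℚ⁺-arrangement n in fromℕ (2 ℕ.* s ℕ.+ n) ℚ.- fromℕ n ≡ fromℕ 2 ℚ.* fromℕ s
  left n = begin
    fromℕ (2 ℕ.* s ℕ.+ n) ℚ.- fromℕ n          ≡⟨ cong (ℚ._- fromℕ n) (fromℕ-+ (2 ℕ.* s) n) ⟩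
    fromℕ (2 ℕ.* s) ℚ.+ fromℕ n ℚ.- fromℕ n    ≡⟨ ℚ.+-assoc (fromℕ (2 ℕ.* s)) (fromℕ n) (ℚ.- fromℕ n) ⟩
    fromℕ (2 ℕ.* s) ℚ.+ (fromℕ n ℚ.- fromℕ n)  ≡⟨ cong (fromℕ (2 ℕ.* s) ℚ.+_) (ℚ.+-inverseʳ (fromℕ n)) ⟩
    fromℕ (2 ℕ.* s) ℚ.+ 0ℚ                     ≡⟨ ℚ.+-identityʳ (fromℕ (2 ℕ.* s)) ⟩
    fromℕ (2 ℕ.* s)                            ≡⟨ fromℕ-* 2 s ⟩
    fromℕ 2 ℚ.* fromℕ s                        ∎
    where s = size ℚ⁺-arrangement n

  right : ∀ n → fromℕ (n ℕ.^ 3) ℚ.- fromℕ n ≡ fromℕ 2 ℚ.* (½ ℚ.* ((α ^ 3) n ℚ.- fromℕ n))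
  right n = begin
    fromℕ (n ℕ.^ 3) ℚ.- fromℕ n                  ≡⟨ cong (ℚ._- fromℕ n) (α^ n 3) ⟨
    (α ^ 3) n ℚ.- fromℕ n                        ≡⟨ ℚ.*-identityˡ ((α ^ 3) n ℚ.- fromℕ n) ⟨
    -- Here 2 · ½ evaluates to 1.
    1ℚ ℚ.* ((α ^ 3) n ℚ.- fromℕ n)               ≡⟨ ℚ.*-assoc (fromℕ 2) ½ ((α ^ 3) n ℚ.- fromℕ n) ⟩
    fromℕ 2 ℚ.* (½ ℚ.* ((α ^ 3) n ℚ.- fromℕ n))  ∎

theorem11 :
      (σ ℚ⁺-arrangement ≋ (α + const 1ℚ) * σ 𝕀-arrangement)
    × ((n : ℕ) → n ≥ 1 → size ℚ⁺-arrangement n ≡ (n ℕ.+ 1) ℕ.* Φ n)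
    × (σ ℚ⁺-arrangement ≈ℱ α ^ 3)
    × (const (+ 3 / 10) * (α ^ 3 + α ^ 2) <ℱ σ ℚ⁺-arrangement)
    × (σ ℚ⁺-arrangement <ℱ const ½ * (α ^ 3 - α))
theorem11 = σ-factorisation , size-ℚ⁺ , σ-≈ℱ-α³ , σ-lower , σ-upper
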